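{- Let $n\geq 3$ be an integer and let $G=\mathrm{Q}_{4n}$ be the generalized quaternion group of order $4n$. Suppose that $G$ has the $m$-DCI property for some integer $m$ with $1\leq m\leq 2n-1$. Then $n$ is odd, and $n$ is not divisible by $p^2$ for any prime $p\leq m-1$.
   Context: The generalized quaternion (dicyclic) group of order $4n$ is $\mathrm{Q}_{4n}=\langle a,b\mid a^{2n}=1,\ b^2=a^n,\ b^{ -1}ab=a^{ -1}\rangle$. For a finite group $G$ and a subset $S\subseteq G$ with $1\notin S$, the Cayley digraph $\mathrm{Cay}(G,S)$ is the digraph with vertex set $G$ and arc set $\{(g,sg)\mid g\in G,\ s\in S\}$; its valency is $|S|$. $\mathrm{Cay}(G,S)$ is called a CI-digraph if for every subset $T\subseteq G$ with $1\notin T$ such that $\mathrm{Cay}(G,T)\cong\mathrm{Cay}(G,S)$ as digraphs, there exists $\sigma\in\mathrm{Aut}(G)$ with $S^\sigma=T$. For a positive integer $m$, $G$ has the $m$-DCI property if every Cayley digraph $\mathrm{Cay}(G,S)$ of $G$ with $|S|=m$ is a CI-digraph. -}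

module Defs where

open import Algebra.Bundles using (Group; AbelianGroup)
open import Algebra.Morphism.Structures using (IsGroupHomomorphism; IsGroupIsomorphism)
open import Algebra.Structures using (IsGroup; IsAbelianGroup)
import Algebra.Definitions.RawMonoid as RawMonoidDefs
import Algebra.Properties.AbelianGroup as AbelianGroupProperties
import Algebra.Properties.CommutativeSemigroup as CommutativeSemigroupProperties
import Algebra.Properties.Group as GroupProperties
import Algebra.Properties.Monoid.Mult as MonoidMult
open import Data.Bool using (Bool; T)
open import Data.Fin using (Fin; toℕ)
open import Data.Fin.Patterns using (0F; 1F)
open import Data.Fin.Properties using (toℕ-injective; toℕ<n; toℕ-fromℕ<; *↔×)
open import Data.Nat using (ℕ; zero; suc; _+_; _*_; _∸_; NonZero)
open import Data.Nat.DivMod using (_%_; _/_; _mod_; m%n<n; m<n⇒m%n≡m; [m+n]%n≡m%n; %-distribˡ-+; m≡m%n+[m/n]*n)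
open import Data.Nat.Properties using (+-assoc; +-comm; +-identityʳ; *-comm; *-assoc; m*n≢0; m∸n+n≡m; <⇒≤)
open import Data.Product using (_×_; _,_; ∃)
open import Function.Bundles using (_↔_; _⇔_; Inverse)
open import Function.Properties.Inverse using (↔-sym)
open import Level using (Level; 0ℓ)
open import Relation.Binary.PropositionalEquality using (_≡_; refl; sym; trans; cong; cong₂; subst; isEquivalence; module ≡-Reasoning)
open import Relation.Nullary using (¬_)
import Relation.Binary.Reasoning.Setoid as SetoidReasoning

record Digraph : Set₁ where
  field
    Vertex : Set
    Arc    : Vertex → Vertex → Set

infix 4 _≅_

record _≅_ (Γ Δ : Digraph) : Set where
  private
    module Γ = Digraph Γ
    module Δ = Digraph Δ
  field
    bijection : Γ.Vertex ↔ Δ.Vertex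
  open Inverse bijection using (to)
  field
    arcs : ∀ u v → Γ.Arc u v ⇔ Δ.Arc (to u) (to v)

record FiniteGroup : Set₁ where
  infixl 7 _∙_
  infix  8 _⁻¹
  field
    Carrier     : Set
    _∙_         : Carrier → Carrier → Carrier
    ε           : Carrier
    _⁻¹         : Carrier → Carrier
    isGroup     : IsGroup _≡_ _∙_ ε _⁻¹
    order       : ℕ
    enumeration : Carrier ↔ Fin order

  group : Group 0ℓ 0ℓ
  group = record { isGroup = isGroup }

  open Group group public using (rawGroup)

-- Subsets are given by characteristic functions, so membership is decidable.
Subset : Set → Set
Subset A = A → Bool

infix 4 _∈_ _∉_

_∈_ _∉_ : {A : Set} → A → Subset A → Set
x ∈ S = T (S x)
x ∉ S = ¬ (x ∈ S)

HasSize : {A : Set} → Subset A → ℕ → Set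
HasSize S m = ∃ (_∈ S) ↔ Fin m

module _ (G : FiniteGroup) where
  open FiniteGroup G

  Cay : Subset Carrier → Digraph
  Cay S = record
    { Vertex = Carrier
    ; Arc    = λ g h → ∃ λ s → s ∈ S × h ≡ s ∙ g
    }

  IsAutomorphism : (Carrier → Carrier) → Set
  IsAutomorphism = IsGroupIsomorphism rawGroup rawGroup

  IsImage : (Carrier → Carrier) → Subset Carrier → Subset Carrier → Set
  IsImage σ S U = ∀ h → h ∈ U ⇔ (∃ λ g → g ∈ S × σ g ≡ h)

  IsCIDigraph : Subset Carrier → Set
  IsCIDigraph S = (U : Subset Carrier) → ε ∉ U → Cay U ≅ Cay S →
                  ∃ λ σ → IsAutomorphism σ × IsImage σ S U

  HasDCI : ℕ → Set
  HasDCI m = (S : Subset Carrier) → ε ∉ S → HasSize S m → IsCIDigraph S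

module Cyclic (N : ℕ) .{{_ : NonZero N}} where

  infixl 6 _⊕_
  infix  8 ⊖_

  _⊕_ : Fin N → Fin N → Fin N
  i ⊕ j = (toℕ i + toℕ j) mod N

  ⊖_ : Fin N → Fin N
  ⊖ i = (N ∸ toℕ i) mod N

  𝟎 : Fin N
  𝟎 = 0 mod N

  toℕ-mod : ∀ k → toℕ (k mod N) ≡ k % N
  toℕ-mod k = toℕ-fromℕ< (m%n<n k N)

  mod-cong : ∀ {j k} → j % N ≡ k % N → j mod N ≡ k mod N
  mod-cong {j} {k} eq = toℕ-injective (trans (toℕ-mod j) (trans eq (sym (toℕ-mod k))))

  mod-toℕ : ∀ i → toℕ i mod N ≡ i
  mod-toℕ i = toℕ-injective (trans (toℕ-mod (toℕ i)) (m<n⇒m%n≡m (toℕ<n i)))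

  mod-homo-+ : ∀ j k → (j mod N) ⊕ (k mod N) ≡ (j + k) mod N
  mod-homo-+ j k = mod-cong (trans
    (cong₂ (λ u v → (u + v) % N) (toℕ-mod j) (toℕ-mod k))
    (sym (%-distribˡ-+ j k N)))

  N-mod : N mod N ≡ 𝟎
  N-mod = mod-cong ([m+n]%n≡m%n 0 N)

  ⊕-comm : ∀ i j → i ⊕ j ≡ j ⊕ i
  ⊕-comm i j = cong (_mod N) (+-comm (toℕ i) (toℕ j))

  ⊕-assoc : ∀ i j k → (i ⊕ j) ⊕ k ≡ i ⊕ (j ⊕ k)
  ⊕-assoc i j k = begin
    (i ⊕ j) ⊕ k                              ≡⟨ cong ((i ⊕ j) ⊕_) (mod-toℕ k) ⟨
    (i ⊕ j) ⊕ (toℕ k mod N)                  ≡⟨ mod-homo-+ (toℕ i + toℕ j) (toℕ k) ⟩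
    (toℕ i + toℕ j + toℕ k) mod N            ≡⟨ cong (_mod N) (+-assoc (toℕ i) (toℕ j) (toℕ k)) ⟩
    (toℕ i + (toℕ j + toℕ k)) mod N          ≡⟨ mod-homo-+ (toℕ i) (toℕ j + toℕ k) ⟨
    (toℕ i mod N) ⊕ (j ⊕ k)                  ≡⟨ cong (_⊕ (j ⊕ k)) (mod-toℕ i) ⟩
    i ⊕ (j ⊕ k)                              ∎
    where open ≡-Reasoning

  ⊕-identityˡ : ∀ i → 𝟎 ⊕ i ≡ i
  ⊕-identityˡ i = begin
    𝟎 ⊕ i              ≡⟨ cong (𝟎 ⊕_) (mod-toℕ i) ⟨
    𝟎 ⊕ (toℕ i mod N)  ≡⟨ mod-homo-+ 0 (toℕ i) ⟩
    toℕ i mod N        ≡⟨ mod-toℕ i ⟩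
    i                  ∎
    where open ≡-Reasoning

  ⊕-inverseˡ : ∀ i → ⊖ i ⊕ i ≡ 𝟎
  ⊕-inverseˡ i = begin
    ⊖ i ⊕ i                    ≡⟨ cong (⊖ i ⊕_) (mod-toℕ i) ⟨
    ⊖ i ⊕ (toℕ i mod N)        ≡⟨ mod-homo-+ (N ∸ toℕ i) (toℕ i) ⟩
    (N ∸ toℕ i + toℕ i) mod N  ≡⟨ cong (_mod N) (m∸n+n≡m (<⇒≤ (toℕ<n i))) ⟩
    N mod N                    ≡⟨ N-mod ⟩
    𝟎                          ∎
    where open ≡-Reasoning

  ⊕-isAbelianGroup : IsAbelianGroup _≡_ _⊕_ 𝟎 ⊖_
  ⊕-isAbelianGroup = record
    { isGroup = record
      { isMonoid = record
        { isSemigroup = record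
          { isMagma = record { isEquivalence = isEquivalence ; ∙-cong = cong₂ _⊕_ }
          ; assoc   = ⊕-assoc
          }
        ; identity = ⊕-identityˡ , λ i → trans (⊕-comm i 𝟎) (⊕-identityˡ i)
        }
      ; inverse = ⊕-inverseˡ , λ i → trans (⊕-comm i (⊖ i)) (⊕-inverseˡ i)
      ; ⁻¹-cong = cong ⊖_
      }
    ; comm = ⊕-comm
    }

  ⊕-abelianGroup : AbelianGroup 0ℓ 0ℓ
  ⊕-abelianGroup = record { isAbelianGroup = ⊕-isAbelianGroup }

module Dicyclic (n : ℕ) .{{_ : NonZero n}} where

  instance
    2n≢0 : NonZero (2 * n)
    2n≢0 = m*n≢0 2 n

  open Cyclic (2 * n) public
  private
    module A  = AbelianGroup ⊕-abelianGroup
    module AP = AbelianGroupProperties ⊕-abelianGroup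
    module CS = CommutativeSemigroupProperties A.commutativeSemigroup

  -- The pair (i , j) stands for aⁱbʲ.
  Element : Set
  Element = Fin (2 * n) × Fin 2

  ν : Fin (2 * n)
  ν = n mod (2 * n)

  -- Since b⁻¹ab = a⁻¹ and b² = aⁿ, we have baᵏ = a⁻ᵏb and
  -- (aⁱb)(aᵏb) = aⁱ⁻ᵏ⁺ⁿ.
  infixl 7 _·_
  infix  8 _⁻¹

  _·_ : Element → Element → Element
  (i , 0F) · (k , l)  = i ⊕ k , l
  (i , 1F) · (k , 0F) = i ⊕ ⊖ k , 1F
  (i , 1F) · (k , 1F) = i ⊕ ⊖ k ⊕ ν , 0F

  _⁻¹ : Element → Element
  (i , 0F) ⁻¹ = ⊖ i , 0F
  (i , 1F) ⁻¹ = i ⊕ ν , 1F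

  e a b : Element
  e = 𝟎 , 0F
  a = 1 mod (2 * n) , 0F
  b = 𝟎 , 1F

  ν⊕ν : ν ⊕ ν ≡ 𝟎
  ν⊕ν = trans (mod-homo-+ n n)
        (trans (cong (λ k → (n + k) mod (2 * n)) (sym (+-identityʳ n))) N-mod)

  ⊖ν : ⊖ ν ≡ ν
  ⊖ν = sym (AP.inverseˡ-unique ν ν ν⊕ν)

  private
    ⊖-⊕ : ∀ k l → ⊖ (k ⊕ l) ≡ ⊖ k ⊕ ⊖ l
    ⊖-⊕ k l = sym (AP.⁻¹-∙-comm k l)

    sub-⊕ : ∀ i k l → i ⊕ ⊖ k ⊕ ⊖ l ≡ i ⊕ ⊖ (k ⊕ l)
    sub-⊕ i k l = trans (⊕-assoc i _ _) (cong (i ⊕_) (sym (⊖-⊕ k l)))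

    sub-⊖ : ∀ i k l → i ⊕ ⊖ k ⊕ l ≡ i ⊕ ⊖ (k ⊕ ⊖ l)
    sub-⊖ i k l = trans (cong (i ⊕ ⊖ k ⊕_) (sym (AP.⁻¹-involutive l))) (sub-⊕ i k (⊖ l))

    swapʳ : ∀ i j k → i ⊕ j ⊕ k ≡ i ⊕ k ⊕ j
    swapʳ i j k = CS.xy∙z≈xz∙y i j k

  ·-assoc : ∀ u v w → (u · v) · w ≡ u · (v · w)
  ·-assoc (i , 0F) (k , 0F) (l , _)  = cong (_, _) (⊕-assoc i k l)
  ·-assoc (i , 0F) (k , 1F) (l , 0F) = cong (_, 1F) (⊕-assoc i k (⊖ l))
  ·-assoc (i , 0F) (k , 1F) (l , 1F) = cong (_, 0F)
    (trans (cong (_⊕ ν) (⊕-assoc i k (⊖ l))) (⊕-assoc i _ ν))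
  ·-assoc (i , 1F) (k , 0F) (l , 0F) = cong (_, 1F) (sub-⊕ i k l)
  ·-assoc (i , 1F) (k , 0F) (l , 1F) = cong (λ t → t ⊕ ν , 0F) (sub-⊕ i k l)
  ·-assoc (i , 1F) (k , 1F) (l , 0F) = cong (_, 0F)
    (trans (swapʳ _ ν l) (cong (_⊕ ν) (sub-⊖ i k l)))
  ·-assoc (i , 1F) (k , 1F) (l , 1F) = cong (_, 1F) (begin
    i ⊕ ⊖ k ⊕ ν ⊕ l          ≡⟨ swapʳ _ ν l ⟩
    i ⊕ ⊖ k ⊕ l ⊕ ν          ≡⟨ cong (_⊕ ν) (sub-⊖ i k l) ⟩
    i ⊕ ⊖ (k ⊕ ⊖ l) ⊕ ν      ≡⟨ cong (i ⊕ ⊖ (k ⊕ ⊖ l) ⊕_) ⊖ν ⟨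
    i ⊕ ⊖ (k ⊕ ⊖ l) ⊕ ⊖ ν    ≡⟨ sub-⊕ i _ ν ⟩
    i ⊕ ⊖ (k ⊕ ⊖ l ⊕ ν)      ∎)
    where open ≡-Reasoning

  ·-identityˡ : ∀ u → e · u ≡ u
  ·-identityˡ (i , _) = cong (_, _) (⊕-identityˡ i)

  ·-identityʳ : ∀ u → u · e ≡ u
  ·-identityʳ (i , 0F) = cong (_, 0F) (A.identityʳ i)
  ·-identityʳ (i , 1F) = cong (_, 1F) (trans (cong (i ⊕_) AP.ε⁻¹≈ε) (A.identityʳ i))

  ·-inverseˡ : ∀ u → u ⁻¹ · u ≡ e
  ·-inverseˡ (i , 0F) = cong (_, 0F) (⊕-inverseˡ i)
  ·-inverseˡ (i , 1F) = cong (_, 0F) (begin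
    i ⊕ ν ⊕ ⊖ i ⊕ ν    ≡⟨ cong (_⊕ ν) (swapʳ i ν (⊖ i)) ⟩
    i ⊕ ⊖ i ⊕ ν ⊕ ν    ≡⟨ ⊕-assoc _ ν ν ⟩
    i ⊕ ⊖ i ⊕ (ν ⊕ ν)  ≡⟨ cong₂ _⊕_ (A.inverseʳ i) ν⊕ν ⟩
    𝟎 ⊕ 𝟎              ≡⟨ ⊕-identityˡ 𝟎 ⟩
    𝟎                  ∎)
    where open ≡-Reasoning

  ·-inverseʳ : ∀ u → u · u ⁻¹ ≡ e
  ·-inverseʳ (i , 0F) = cong (_, 0F) (A.inverseʳ i)
  ·-inverseʳ (i , 1F) = cong (_, 0F) (begin
    i ⊕ ⊖ (i ⊕ ν) ⊕ ν    ≡⟨ cong (_⊕ ν) (sub-⊕ i i ν) ⟨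
    i ⊕ ⊖ i ⊕ ⊖ ν ⊕ ν    ≡⟨ ⊕-assoc _ (⊖ ν) ν ⟩
    i ⊕ ⊖ i ⊕ (⊖ ν ⊕ ν)  ≡⟨ cong₂ _⊕_ (A.inverseʳ i) (⊕-inverseˡ ν) ⟩
    𝟎 ⊕ 𝟎                ≡⟨ ⊕-identityˡ 𝟎 ⟩
    𝟎                    ∎)
    where open ≡-Reasoning

  ·-isGroup : IsGroup _≡_ _·_ e _⁻¹
  ·-isGroup = record
    { isMonoid = record
      { isSemigroup = record
        { isMagma = record { isEquivalence = isEquivalence ; ∙-cong = cong₂ _·_ }
        ; assoc   = ·-assoc
        }
      ; identity = ·-identityˡ , ·-identityʳ
      }
    ; inverse = ·-inverseˡ , ·-inverseʳ
    ; ⁻¹-cong = cong _⁻¹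
    }

  2n*2≡4n : 2 * n * 2 ≡ 4 * n
  2n*2≡4n = trans (*-comm (2 * n) 2) (sym (*-assoc 2 2 n))

  Q : FiniteGroup
  Q = record
    { Carrier     = Element
    ; _∙_         = _·_
    ; ε           = e
    ; _⁻¹         = _⁻¹
    ; isGroup     = ·-isGroup
    ; order       = 4 * n
    ; enumeration = subst (λ k → Element ↔ Fin k) 2n*2≡4n (↔-sym *↔×)
    }

Q₄ : (n : ℕ) .{{_ : NonZero n}} → FiniteGroup
Q₄ n = Dicyclic.Q n

-- Q₄ n is the group ⟨ a , b ∣ a²ⁿ = 1 , b² = aⁿ , b⁻¹ab = a⁻¹ ⟩: its
-- elements a and b satisfy the relations, and it is universal among
-- groups with two such elements.

record DicyclicRelations (n : ℕ) {c ℓ : Level} (H : Group c ℓ) (x y : Group.Carrier H) : Set ℓ where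
  open Group H
  open RawMonoidDefs rawMonoid using () renaming (_×_ to pow)
  field
    x²ⁿ≈1     : pow (2 * n) x ≈ ε
    y²≈xⁿ     : pow 2 y ≈ pow n x
    y⁻¹xy≈x⁻¹ : y ⁻¹ ∙ x ∙ y ≈ x ⁻¹

module Presentation (n : ℕ) .{{_ : NonZero n}} where
  open Dicyclic n
  private
    module Q = Group (FiniteGroup.group (Q₄ n))
    module A = AbelianGroup ⊕-abelianGroup
    module AP = AbelianGroupProperties ⊕-abelianGroup
    module CS = CommutativeSemigroupProperties A.commutativeSemigroup
  open RawMonoidDefs Q.rawMonoid using () renaming (_×_ to pow)

  pow-a : ∀ k → pow k a ≡ (k mod (2 * n) , 0F)
  pow-a zero    = refl
  pow-a (suc k) = trans (cong (a ·_) (pow-a k)) (cong (_, 0F) (mod-homo-+ 1 k))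

  relations : DicyclicRelations n (FiniteGroup.group (Q₄ n)) a b
  relations = record
    { x²ⁿ≈1     = trans (pow-a (2 * n)) (cong (_, 0F) N-mod)
    ; y²≈xⁿ     = trans (cong (b ·_) (·-identityʳ b))
                 (trans (cong (λ t → t ⊕ ν , 0F) (A.inverseʳ 𝟎))
                 (trans (cong (_, 0F) (⊕-identityˡ ν)) (sym (pow-a n))))
    ; y⁻¹xy≈x⁻¹ = cong (_, 0F) (begin
        𝟎 ⊕ ν ⊕ ⊖ α ⊕ ⊖ 𝟎 ⊕ ν  ≡⟨ cong (λ t → 𝟎 ⊕ ν ⊕ ⊖ α ⊕ t ⊕ ν) AP.ε⁻¹≈ε ⟩
        𝟎 ⊕ ν ⊕ ⊖ α ⊕ 𝟎 ⊕ ν    ≡⟨ cong (_⊕ ν) (A.identityʳ _) ⟩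
        𝟎 ⊕ ν ⊕ ⊖ α ⊕ ν        ≡⟨ cong (λ t → t ⊕ ⊖ α ⊕ ν) (⊕-identityˡ ν) ⟩
        ν ⊕ ⊖ α ⊕ ν            ≡⟨ CS.xy∙z≈xz∙y ν (⊖ α) ν ⟩
        ν ⊕ ν ⊕ ⊖ α            ≡⟨ cong (_⊕ ⊖ α) ν⊕ν ⟩
        𝟎 ⊕ ⊖ α                ≡⟨ ⊕-identityˡ (⊖ α) ⟩
        ⊖ α                    ∎)
    }
    where
    open ≡-Reasoning
    α = 1 mod (2 * n)

  module _ {c ℓ : Level} (H : Group c ℓ) where
    private
      module H  = Group H
      module HP = GroupProperties H
      module HM = MonoidMult H.monoid
    open H using (_∙_; _≈_)

    IsHom : (Element → H.Carrier) → Set ℓ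
    IsHom = IsGroupHomomorphism Q.rawGroup H.rawGroup

    module _ (x y : H.Carrier) (rel : DicyclicRelations n H x y) where
      open DicyclicRelations rel
      open SetoidReasoning H.setoid

      private
        P : Fin (2 * n) → H.Carrier
        P i = toℕ i HM.× x

        pow-q*2n : ∀ q → (q * (2 * n)) HM.× x ≈ H.ε
        pow-q*2n zero    = H.refl
        pow-q*2n (suc q) = begin
          (2 * n + q * (2 * n)) HM.× x                ≈⟨ HM.×-homo-+ x (2 * n) (q * (2 * n)) ⟩
          (2 * n) HM.× x ∙ (q * (2 * n)) HM.× x       ≈⟨ H.∙-cong x²ⁿ≈1 (pow-q*2n q) ⟩
          H.ε ∙ H.ε                                   ≈⟨ H.identityˡ H.ε ⟩
          H.ε                                         ∎

        P-mod : ∀ k → P (k mod (2 * n)) ≈ k HM.× x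
        P-mod k = begin
          P (k mod (2 * n))                                       ≈⟨ HM.×-congˡ (toℕ-mod k) ⟩
          (k % (2 * n)) HM.× x                                    ≈⟨ H.identityʳ _ ⟨
          (k % (2 * n)) HM.× x ∙ H.ε                              ≈⟨ H.∙-congˡ (pow-q*2n (k / (2 * n))) ⟨
          (k % (2 * n)) HM.× x ∙ (k / (2 * n) * (2 * n)) HM.× x   ≈⟨ HM.×-homo-+ x (k % (2 * n)) _ ⟨
          (k % (2 * n) + k / (2 * n) * (2 * n)) HM.× x            ≈⟨ HM.×-congˡ (m≡m%n+[m/n]*n k (2 * n)) ⟨
          k HM.× x                                                ∎

        P-⊕ : ∀ i k → P (i ⊕ k) ≈ P i ∙ P k
        P-⊕ i k = H.trans (P-mod (toℕ i + toℕ k)) (HM.×-homo-+ x (toℕ i) (toℕ k))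

        P-⊖ : ∀ k → P (⊖ k) ∙ P k ≈ H.ε
        P-⊖ k = begin
          P (⊖ k) ∙ P k  ≈⟨ P-⊕ (⊖ k) k ⟨
          P (⊖ k ⊕ k)    ≡⟨ cong P (⊕-inverseˡ k) ⟩
          P 𝟎            ≈⟨ P-mod 0 ⟩
          H.ε            ∎

        P-ν : P ν ≈ y ∙ y
        P-ν = begin
          P ν            ≈⟨ P-mod n ⟩
          n HM.× x       ≈⟨ y²≈xⁿ ⟨
          y ∙ (y ∙ H.ε)  ≈⟨ H.∙-congˡ (H.identityʳ y) ⟩
          y ∙ y          ∎

        xy≈yx⁻¹ : x ∙ y ≈ y ∙ x H.⁻¹
        xy≈yx⁻¹ = begin
          x ∙ y                     ≈⟨ HP.\\-leftDividesˡ y (x ∙ y) ⟨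
          y ∙ (y H.⁻¹ ∙ (x ∙ y))    ≈⟨ H.∙-congˡ (H.assoc (y H.⁻¹) x y) ⟨
          y ∙ (y H.⁻¹ ∙ x ∙ y)      ≈⟨ H.∙-congˡ y⁻¹xy≈x⁻¹ ⟩
          y ∙ x H.⁻¹                ∎

        xyx≈y : x ∙ y ∙ x ≈ y
        xyx≈y = begin
          x ∙ y ∙ x           ≈⟨ H.∙-congʳ xy≈yx⁻¹ ⟩
          y ∙ x H.⁻¹ ∙ x      ≈⟨ HP.//-rightDividesˡ x y ⟩
          y                   ∎

        pow-sucʳ : ∀ k → suc k HM.× x ≈ k HM.× x ∙ x
        pow-sucʳ k = begin
          suc k HM.× x               ≈⟨ HM.×-congˡ (+-comm 1 k) ⟩
          (k + 1) HM.× x             ≈⟨ HM.×-homo-+ x k 1 ⟩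
          k HM.× x ∙ 1 HM.× x        ≈⟨ H.∙-congˡ (HM.×-homo-1 x) ⟩
          k HM.× x ∙ x               ∎

        xᵏyxᵏ≈y : ∀ k → k HM.× x ∙ y ∙ k HM.× x ≈ y
        xᵏyxᵏ≈y zero    = H.trans (H.identityʳ _) (H.identityˡ y)
        xᵏyxᵏ≈y (suc k) = begin
          suc k HM.× x ∙ y ∙ (x ∙ k HM.× x)     ≈⟨ H.∙-congʳ (H.∙-congʳ (pow-sucʳ k)) ⟩
          k HM.× x ∙ x ∙ y ∙ (x ∙ k HM.× x)     ≈⟨ H.assoc _ x _ ⟨
          k HM.× x ∙ x ∙ y ∙ x ∙ k HM.× x       ≈⟨ H.∙-congʳ (H.∙-congʳ (H.assoc _ x y)) ⟩
          k HM.× x ∙ (x ∙ y) ∙ x ∙ k HM.× x     ≈⟨ H.∙-congʳ (H.assoc _ _ x) ⟩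
          k HM.× x ∙ (x ∙ y ∙ x) ∙ k HM.× x     ≈⟨ H.∙-congʳ (H.∙-congˡ xyx≈y) ⟩
          k HM.× x ∙ y ∙ k HM.× x               ≈⟨ xᵏyxᵏ≈y k ⟩
          y                                     ∎

        y-P : ∀ k → P (⊖ k) ∙ y ≈ y ∙ P k
        y-P k = begin
          P (⊖ k) ∙ y                   ≈⟨ H.∙-congˡ (xᵏyxᵏ≈y (toℕ k)) ⟨
          P (⊖ k) ∙ (P k ∙ y ∙ P k)     ≈⟨ H.∙-congˡ (H.assoc (P k) y (P k)) ⟩
          P (⊖ k) ∙ (P k ∙ (y ∙ P k))   ≈⟨ H.assoc _ (P k) _ ⟨
          P (⊖ k) ∙ P k ∙ (y ∙ P k)     ≈⟨ H.∙-congʳ (P-⊖ k) ⟩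
          H.ε ∙ (y ∙ P k)               ≈⟨ H.identityˡ _ ⟩
          y ∙ P k                       ∎

        P⊖y : ∀ i k → P (i ⊕ ⊖ k) ∙ y ≈ P i ∙ y ∙ P k
        P⊖y i k = begin
          P (i ⊕ ⊖ k) ∙ y       ≈⟨ H.∙-congʳ (P-⊕ i (⊖ k)) ⟩
          P i ∙ P (⊖ k) ∙ y     ≈⟨ H.assoc _ _ y ⟩
          P i ∙ (P (⊖ k) ∙ y)   ≈⟨ H.∙-congˡ (y-P k) ⟩
          P i ∙ (y ∙ P k)       ≈⟨ H.assoc _ y _ ⟨
          P i ∙ y ∙ P k         ∎

      lift : Element → H.Carrier
      lift (i , 0F) = P i
      lift (i , 1F) = P i ∙ y

      lift-homo : ∀ u v → lift (u · v) ≈ lift u ∙ lift v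
      lift-homo (i , 0F) (k , 0F) = P-⊕ i k
      lift-homo (i , 0F) (k , 1F) = H.trans (H.∙-congʳ (P-⊕ i k)) (H.assoc _ _ y)
      lift-homo (i , 1F) (k , 0F) = P⊖y i k
      lift-homo (i , 1F) (k , 1F) = begin
        P (i ⊕ ⊖ k ⊕ ν)            ≈⟨ P-⊕ (i ⊕ ⊖ k) ν ⟩
        P (i ⊕ ⊖ k) ∙ P ν          ≈⟨ H.∙-congˡ P-ν ⟩
        P (i ⊕ ⊖ k) ∙ (y ∙ y)      ≈⟨ H.assoc _ y y ⟨
        P (i ⊕ ⊖ k) ∙ y ∙ y        ≈⟨ H.∙-congʳ (P⊖y i k) ⟩
        P i ∙ y ∙ P k ∙ y          ≈⟨ H.assoc _ _ y ⟩
        P i ∙ y ∙ (P k ∙ y)        ∎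

      lift-ε : lift e ≈ H.ε
      lift-ε = P-mod 0

      lift-isHom : IsHom lift
      lift-isHom = record
        { isMonoidHomomorphism = record
          { isMagmaHomomorphism = record
            { isRelHomomorphism = record { cong = λ { refl → H.refl } }
            ; homo = lift-homo
            }
          ; ε-homo = lift-ε
          }
        ; ⁻¹-homo = λ u → HP.inverseˡ-unique (lift (u ⁻¹)) (lift u) (begin
            lift (u ⁻¹) ∙ lift u  ≈⟨ lift-homo (u ⁻¹) u ⟨
            lift (u ⁻¹ · u)       ≡⟨ cong lift (·-inverseˡ u) ⟩
            lift e                ≈⟨ lift-ε ⟩
            H.ε                   ∎)
        }

      universal : ∃ λ φ → IsHom φ × φ a ≈ x × φ b ≈ y ×
                  (∀ ψ → IsHom ψ → ψ a ≈ x → ψ b ≈ y → ∀ u → ψ u ≈ φ u)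
      universal = lift , lift-isHom
                , H.trans (P-mod 1) (HM.×-homo-1 x)
                , H.trans (H.∙-congʳ lift-ε) (H.identityˡ y)
                , unique
        where
        unique : ∀ ψ → IsHom ψ → ψ a ≈ x → ψ b ≈ y → ∀ u → ψ u ≈ lift u
        unique ψ hom ψa ψb = go
          where
          open IsGroupHomomorphism hom

          ψ-pow : ∀ k → ψ (pow k a) ≈ k HM.× x
          ψ-pow zero    = ε-homo
          ψ-pow (suc k) = H.trans (homo a (pow k a)) (H.∙-cong ψa (ψ-pow k))

          ψ-P : ∀ i → ψ (i , 0F) ≈ P i
          ψ-P i = begin
            ψ (i , 0F)           ≡⟨ cong ψ (trans (pow-a (toℕ i)) (cong (_, 0F) (mod-toℕ i))) ⟨
            ψ (pow (toℕ i) a)    ≈⟨ ψ-pow (toℕ i) ⟩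
            P i                  ∎

          go : ∀ u → ψ u ≈ lift u
          go (i , 0F) = ψ-P i
          go (i , 1F) = begin
            ψ (i , 1F)           ≡⟨ cong (λ t → ψ (t , 1F)) (A.identityʳ i) ⟨
            ψ ((i , 0F) · b)     ≈⟨ homo (i , 0F) b ⟩
            ψ (i , 0F) ∙ ψ b     ≈⟨ H.∙-cong (ψ-P i) ψb ⟩
            P i ∙ y              ∎

{-# OPTIONS --safe #-}
-- Automorphisms of the group preserve ⟨a⟩, because a commutes with ⟨a⟩ while
-- aⁱb commutes with aᵏ only if a²ᵏ = 1.
--
-- If n is even, a subset S of ⟨a⟩ ≅ ℤ/2n invariant under s ↦ −s for even s and
-- s ↦ n − s for odd s gives a digraph on which ⟨a², b⟩ also acts regularly, so
-- Cay(G, S) ≅ Cay(G, U) with U ⊆ ⟨a², b⟩, and U ⊈ ⟨a⟩ as soon as S has an odd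
-- element.  Such S exist in every size 2 ≤ m ≤ 2n − 1; for m = 1 the elements
-- a^(n/2) and b both have order 4.
--
-- If p is odd and p² ∣ n, let aᶜ have order p², P = ⟨aᶜᵖ⟩ and z = aⁿ.  Take S to
-- be the coset aᶜP, the element aᶜᵖ, some elements of zP and some cosets of P
-- outside ⟨a⟩.  Inverting ⟨z⟩P coset by coset turns Cay(G, S) into Cay(G, U),
-- where U is S with its part in ⟨z⟩P inverted.  An automorphism taking S to U
-- maps aᶜ into aᶜP, so it fixes the p-th power aᶜᵖ ∈ S, which is not in U.
module Submission where

open import Defs
import Algebra.Definitions.RawMonoid as RawMonoidDefs
import Algebra.Properties.AbelianGroup as AbelianGroupProperties
import Algebra.Properties.CommutativeSemigroup as CommutativeSemigroupProperties
import Algebra.Properties.Group as GroupProperties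
import Data.Nat as ℕ
open import Algebra.Bundles using (AbelianGroup; Group)
open import Algebra.Morphism.Structures using (IsGroupIsomorphism)
open import Data.Bool using (Bool; T; _∧_; _∨_; false; if_then_else_; not; true)
open import Data.Bool.Properties using (T-∧; T-∨; T-≡; ∧-identityʳ; ∧-zeroʳ)
open import Data.Empty using (⊥-elim)
open import Data.Fin using (Fin; suc; toℕ; zero)
open import Data.Fin.Patterns using (0F; 1F)
open import Data.Fin.Properties using (+↔⊎; 0↔⊥; 1↔⊤; _≟_; toℕ<n)
open import Data.Nat using (>-nonZero⁻¹; NonZero; _*_; _+_; _<_; _<ᵇ_; _^_; _∸_; _≡ᵇ_; _≤_; suc; s≤s; zero; z≤n; ℕ; ≢-nonZero; ≢-nonZero⁻¹)
open import Data.Nat.DivMod using (%-congʳ; +-distrib-/-∣ʳ; +-distrib-/-∣ˡ; 0/n≡0; [m+kn]%n≡m%n; [m+n]%n≡m%n; _%_; _/_; _mod_; m%[n*o]/o≡m/o%n; m%n%n≡m%n; m%n*o≡m*o%[n*o]; m%n<n; m*n%n≡0; m*n/n≡m; m<n*o⇒m/o<n; m<n⇒m%n≡m; m<n⇒m/n≡0; m∣n⇒o%n%m≡o%m; m≡m%n+[m/n]*n; n%n≡0; n/n≡1)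
open import Data.Nat.Divisibility using (_∣_; divides; m∣m*n; ∣-refl; ∣-trans)
open import Data.Nat.Primality using (Prime; ¬prime[0]; ¬prime[1])
open import Data.Nat.Properties using (*-assoc; *-cancelʳ-≡; *-comm; *-distribˡ-+; *-identityʳ; *-identityˡ; *-monoʳ-≤; *-monoˡ-<; *-monoˡ-≤; *-suc; *-zeroʳ; +-assoc; +-comm; +-identityʳ; 0≢1+n; <-trans; <⇒≢; <⇒≤; m*n≢0; m+[n∸m]≡n; m+n∸m≡n; m<m+n; m<n+m; module ≤-Reasoning; m∸n≤m; m≤m+n; n≢0⇒n>0; n≤1+n; suc-injective; ∸-monoʳ-<; ≡ᵇ⇒≡; ≡⇒≡ᵇ; ≤-refl; ≤-reflexive; ≤-trans; ≤∧≢⇒<)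
open import Data.Nat.Tactic.RingSolver using (solve-∀)
open import Data.Product using (_,_; _×_; proj₁; proj₂; ∃)
open import Data.Sum using (_⊎_; inj₁; inj₂)
open import Data.Sum.Function.Propositional using (_⊎-↔_)
open import Function using (_∘_; id)
open import Function.Bundles using (Equivalence; _↔_; _⇔_; mk↔ₛ′; mk⇔)
open import Function.Properties.Inverse using (↔-sym; ↔-trans)
open import Relation.Binary.PropositionalEquality using (_≗_; _≡_; _≢_; cong; cong₂; module ≡-Reasoning; refl; subst; subst₂; sym; trans)
open import Relation.Nullary using (contradiction; does; no; yes; ¬_)

-- Sizes of decidable subsets of `Fin N`

bit : Bool → ℕ
bit b = if b then 1 else 0

count : ∀ {N} → Subset (Fin N) → ℕ
count {zero}  f = 0
count {suc N} f = bit (f zero) + count (f ∘ suc)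

T↔Fin : ∀ b → T b ↔ Fin (bit b)
T↔Fin false = ↔-sym 0↔⊥
T↔Fin true  = ↔-sym 1↔⊤

hasSize-count : ∀ {N} (f : Subset (Fin N)) → HasSize f (count f)
hasSize-count {zero}  f = mk↔ₛ′ (λ ()) (λ ()) (λ ()) (λ ())
hasSize-count {suc N} f =
  ↔-trans split (↔-trans (T↔Fin (f zero) ⊎-↔ hasSize-count (f ∘ suc)) (↔-sym +↔⊎))
  where
  split : ∃ (_∈ f) ↔ (T (f zero) ⊎ ∃ (_∈ f ∘ suc))
  split = mk↔ₛ′
    (λ { (zero , t) → inj₁ t ; (suc i , t) → inj₂ (i , t) })
    (λ { (inj₁ t) → zero , t ; (inj₂ (i , t)) → suc i , t })
    (λ { (inj₁ _) → refl ; (inj₂ _) → refl })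
    (λ { (zero , _) → refl ; (suc _ , _) → refl })

-- When pairs are read as aⁱbʲ, the two sheets are ⟨a⟩ and its other coset ⟨a⟩b.
hasSize-sheets : ∀ {N} (S : Subset (Fin N × Fin 2)) →
                 HasSize S (count (λ i → S (i , 0F)) + count (λ i → S (i , 1F)))
hasSize-sheets S =
  ↔-trans split (↔-trans (hasSize-count _ ⊎-↔ hasSize-count _) (↔-sym +↔⊎))
  where
  split : ∃ (_∈ S) ↔ (∃ (λ i → (i , 0F) ∈ S) ⊎ ∃ (λ i → (i , 1F) ∈ S))
  split = mk↔ₛ′
    (λ { ((i , 0F) , t) → inj₁ (i , t) ; ((i , 1F) , t) → inj₂ (i , t) })
    (λ { (inj₁ (i , t)) → (i , 0F) , t ; (inj₂ (i , t)) → (i , 1F) , t })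
    (λ { (inj₁ _) → refl ; (inj₂ _) → refl })
    (λ { ((_ , 0F) , _) → refl ; ((_ , 1F) , _) → refl })

count-cong : ∀ {N} {f g : Subset (Fin N)} → f ≗ g → count f ≡ count g
count-cong {zero}  f≗g = refl
count-cong {suc N} f≗g = cong₂ (λ b k → bit b + k) (f≗g zero) (count-cong (f≗g ∘ suc))

count-empty : ∀ N → count {N} (λ _ → false) ≡ 0
count-empty zero    = refl
count-empty (suc N) = count-empty N

count-full : ∀ N → count {N} (λ _ → true) ≡ N
count-full zero    = refl
count-full (suc N) = cong suc (count-full N)

count-∨ : ∀ {N} {f g : Subset (Fin N)} → (∀ i → i ∈ f → i ∉ g) →
          count (λ i → f i ∨ g i) ≡ count f + count g
count-∨ {zero}          disj = refl
count-∨ {suc N} {f} {g} disj = trans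
  (cong₂ _+_ (bit-∨ (f zero) (g zero) (disj zero)) (count-∨ (disj ∘ suc)))
  (interchange (bit (f zero)) (bit (g zero)) (count (f ∘ suc)) (count (g ∘ suc)))
  where
  bit-∨ : ∀ x y → (T x → ¬ T y) → bit (x ∨ y) ≡ bit x + bit y
  bit-∨ false y     _ = refl
  bit-∨ true  false _ = refl
  bit-∨ true  true  d = contradiction _ (d _)
  interchange : ∀ a b c d → (a + b) + (c + d) ≡ (a + c) + (b + d)
  interchange = solve-∀

count-point : ∀ {N} (c : Fin N) → count (λ i → does (i ≟ c)) ≡ 1
count-point {suc N} zero    = cong suc (count-empty N)
count-point {suc N} (suc c) = count-point c

point⇒≡ : ∀ {N} (x c : Fin N) → T (does (x ≟ c)) → x ≡ c
point⇒≡ x c t with yes eq ← x ≟ c = eq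

point-refl : ∀ {N} (c : Fin N) → T (does (c ≟ c))
point-refl c with c ≟ c
... | yes _   = _
... | no  c≢c = contradiction refl c≢c

count>0⇒∃ : ∀ {N} (f : Subset (Fin N)) {k} → count f ≡ suc k → ∃ (_∈ f)
count>0⇒∃ {suc N} f eq with f zero in f0
... | true  = zero , Equivalence.from T-≡ f0
... | false = let i , i∈f = count>0⇒∃ (f ∘ suc) eq in suc i , i∈f

infixl 6 _∖_

_∖_ : ∀ {N} → Subset (Fin N) → Fin N → Subset (Fin N)
(f ∖ x) i = f i ∧ not (does (i ≟ x))

∖⇒ : ∀ {N} (f : Subset (Fin N)) (x : Fin N) i → i ∈ f ∖ x → i ∈ f × i ≢ x
∖⇒ f x i t with i ≟ x | f i
... | no i≢x | true = _ , i≢x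
... | yes _  | true  = ⊥-elim t

⇒∖ : ∀ {N} (f : Subset (Fin N)) (x : Fin N) i → i ∈ f → i ≢ x → i ∈ f ∖ x
⇒∖ f x i t i≢x with i ≟ x | f i
... | no _    | true = _
... | yes i≡x | true = i≢x i≡x

count-∖ : ∀ {N} (f : Subset (Fin N)) (x : Fin N) → x ∈ f → count f ≡ suc (count (f ∖ x))
count-∖ f x x∈f = begin
  count f                                            ≡⟨ count-cong restore ⟩
  count (λ i → does (i ≟ x) ∨ (f ∖ x) i)             ≡⟨ count-∨ {f = λ i → does (i ≟ x)} (λ i p q → proj₂ (∖⇒ f x i q) (point⇒≡ i x p)) ⟩
  count (λ i → does (i ≟ x)) + count (f ∖ x)         ≡⟨ cong (_+ count (f ∖ x)) (count-point x) ⟩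
  suc (count (f ∖ x))                                ∎
  where
  open ≡-Reasoning
  restore : ∀ i → f i ≡ does (i ≟ x) ∨ (f ∖ x) i
  restore i with i ≟ x
  ... | yes refl = Equivalence.to T-≡ x∈f
  ... | no  _    = sym (∧-identityʳ (f i))

infixr 5 _◂_

_◂_ : ∀ {N} → Fin N → Subset (Fin N) → Subset (Fin N)
(x ◂ f) i = does (i ≟ x) ∨ f i

◂⇒ : ∀ {N} (x : Fin N) (f : Subset (Fin N)) i → i ∈ x ◂ f → i ≡ x ⊎ i ∈ f
◂⇒ x f i t with i ≟ x
... | yes i≡x = inj₁ i≡x
... | no  _   = inj₂ t

◂-head : ∀ {N} (x : Fin N) (f : Subset (Fin N)) i → i ≡ x → i ∈ x ◂ f
◂-head x f i refl = Equivalence.from T-∨ (inj₁ (point-refl x))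

◂-tail : ∀ {N} (x : Fin N) (f : Subset (Fin N)) i → i ∈ f → i ∈ x ◂ f
◂-tail x f i i∈f = Equivalence.from T-∨ (inj₂ i∈f)

count-◂ : ∀ {N} (x : Fin N) (f : Subset (Fin N)) → x ∉ f → count (x ◂ f) ≡ suc (count f)
count-◂ x f x∉f = trans
  (count-∨ {f = λ i → does (i ≟ x)} {f} (λ i i≡x i∈f → x∉f (subst (_∈ f) (point⇒≡ i x i≡x) i∈f)))
  (cong (_+ count f) (count-point x))

-- Sets closed under an involution

Closed : ∀ {N} → (Fin N → Fin N) → Subset (Fin N) → Set
Closed τ f = ∀ i → i ∈ f → τ i ∈ f

module _ {N} (τ : Fin N → Fin N) (τ-involutive : ∀ i → τ (τ i) ≡ i) where

  insertFixed : ∀ f → Closed τ f → ∀ x → τ x ≡ x → Closed τ (x ◂ f)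
  insertFixed f closed x τx≡x i i∈ with ◂⇒ x f i i∈
  ... | inj₁ refl = ◂-head x f (τ i) τx≡x
  ... | inj₂ i∈f  = ◂-tail x f (τ i) (closed i i∈f)

  insertOrbit : ∀ f → Closed τ f → ∀ x → Closed τ (x ◂ τ x ◂ f)
  insertOrbit f closed x i i∈ with ◂⇒ x (τ x ◂ f) i i∈
  ... | inj₁ refl = ◂-tail x (τ x ◂ f) (τ x) (◂-head (τ x) f (τ x) refl)
  ... | inj₂ i∈′ with ◂⇒ (τ x) f i i∈′
  ...   | inj₁ refl = ◂-head x (τ x ◂ f) (τ i) (τ-involutive x)
  ...   | inj₂ i∈f  = ◂-tail x (τ x ◂ f) (τ i) (◂-tail (τ x) f (τ i) (closed i i∈f))

  removeFixed : ∀ f → Closed τ f → ∀ x → τ x ≡ x → Closed τ (f ∖ x)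
  removeFixed f closed x τx≡x i i∈ =
    let i∈f , i≢x = ∖⇒ f x i i∈
    in ⇒∖ f x (τ i) (closed i i∈f) (λ τi≡x → i≢x (trans (sym (τ-involutive i)) (trans (cong τ τi≡x) τx≡x)))

  removeOrbit : ∀ f → Closed τ f → ∀ x → Closed τ (f ∖ x ∖ τ x)
  removeOrbit f closed x i i∈ =
    ⇒∖ (f ∖ x) (τ x) (τ i) (⇒∖ f x (τ i) (closed i i∈f) (λ τi≡x → i≢τx (trans (sym (τ-involutive i)) (cong τ τi≡x))))
      (λ τi≡τx → i≢x (trans (sym (τ-involutive i)) (trans (cong τ τi≡τx) (τ-involutive x))))
    where
    i∈f∖x = proj₁ (∖⇒ (f ∖ x) (τ x) i i∈)
    i≢τx  = proj₂ (∖⇒ (f ∖ x) (τ x) i i∈)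
    i∈f   = proj₁ (∖⇒ f x i i∈f∖x)
    i≢x   = proj₂ (∖⇒ f x i i∈f∖x)

  private
    count-∖-≤ : ∀ (f : Subset (Fin N)) x → count f ≤ suc (count (f ∖ x))
    count-∖-≤ f x with f x in fx
    ... | true  = ≤-reflexive (count-∖ f x (Equivalence.from T-≡ fx))
    ... | false = ≤-trans (≤-reflexive (count-cong keep)) (n≤1+n _)
      where
      keep : ∀ i → f i ≡ (f ∖ x) i
      keep i with i ≟ x
      ... | yes refl = trans fx (sym (∧-zeroʳ (f i)))
      ... | no  _    = sym (∧-identityʳ (f i))

  -- Orbits of τ have one or two points, so removing orbits one at a time
  -- hits every size up to an error of one.
  closedSubset : ∀ f → Closed τ f → ∀ t → t ≤ suc (count f) →
    ∃ λ g → Closed τ g × (∀ i → i ∈ g → i ∈ f) × (count g ≡ t ⊎ suc (count g) ≡ t)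
  closedSubset f closed t t≤ = go (count f) f ≤-refl closed t≤
    where
    -- `w` bounds the size of `f` and drops with each orbit removed, so the recursion terminates.
    go : ∀ w f → count f ≤ w → Closed τ f → t ≤ suc (count f) →
      ∃ λ g → Closed τ g × (∀ i → i ∈ g → i ∈ f) × (count g ≡ t ⊎ suc (count g) ≡ t)
    go w f ≤w closed t≤ with suc (count f) ℕ.≟ t | count f ℕ.≟ t
    ... | yes eq | _      = f , closed , (λ _ → id) , inj₂ eq
    ... | no _   | yes eq = f , closed , (λ _ → id) , inj₁ eq
    ... | no ≢₁  | no ≢₂ = remove w (count f) refl ≤w
      where
      t<f : t < count f
      t<f = ≤∧≢⇒< (ℕ.s≤s⁻¹ (≤∧≢⇒< t≤ (≢₁ ∘ sym))) (≢₂ ∘ sym)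

      remove : ∀ w c → count f ≡ c → c ≤ w →
        ∃ λ g → Closed τ g × (∀ i → i ∈ g → i ∈ f) × (count g ≡ t ⊎ suc (count g) ≡ t)
      remove w zero eq _ with () ← subst (t <_) eq t<f
      remove (suc w) (suc c) eq (s≤s c≤w) =
        let g , closed′ , g⊆ , size = go w f′ f′≤w (removeOrbit f closed x) t≤f′
        in g , closed′ , (λ i → f′⊆f i ∘ g⊆ i) , size
        where
        x∈f = count>0⇒∃ f eq
        x = proj₁ x∈f
        f′ = f ∖ x ∖ τ x
        f′⊆f : ∀ i → i ∈ f′ → i ∈ f
        f′⊆f i = proj₁ ∘ ∖⇒ f x i ∘ proj₁ ∘ ∖⇒ (f ∖ x) (τ x) i
        c≡ : c ≡ count (f ∖ x)
        c≡ = suc-injective (trans (sym eq) (count-∖ f x (proj₂ x∈f)))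
        count-f′≤ : count f′ ≤ count (f ∖ x)
        count-f′≤ with (f ∖ x) (τ x) in fτx
        ... | true  = ≤-trans (n≤1+n _) (≤-reflexive (sym (count-∖ (f ∖ x) (τ x) (Equivalence.from T-≡ fτx))))
        ... | false = ≤-reflexive (count-cong keep)
          where
          keep : ∀ i → f′ i ≡ (f ∖ x) i
          keep i with i ≟ τ x
          ... | yes refl = trans (∧-zeroʳ _) (sym fτx)
          ... | no  _    = ∧-identityʳ _
        f′≤w : count f′ ≤ w
        f′≤w = ≤-trans count-f′≤ (≤-trans (≤-reflexive (sym c≡)) c≤w)
        -- Removing an orbit costs at most two points, so t < `count f` leaves t at most one above
        -- the new size, which is the slack the statement allows.
        t≤f′ : t ≤ suc (count f′)
        t≤f′ = ≤-trans (ℕ.s≤s⁻¹ (subst (t <_) eq t<f)) (≤-trans (≤-reflexive c≡) (count-∖-≤ (f ∖ x) (τ x)))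

-- Counting by remainder and quotient

count-+ : ∀ M {N} (f : ℕ → Bool) →
  count {M + N} (f ∘ toℕ) ≡ count {M} (f ∘ toℕ) + count {N} (f ∘ (M +_) ∘ toℕ)
count-+ zero    f = refl
count-+ (suc M) f = trans (cong (bit (f 0) +_) (count-+ M (f ∘ suc)))
                          (sym (+-assoc (bit (f 0)) _ _))

count-< : ∀ {t N} → t ≤ N → count {N} ((_<ᵇ t) ∘ toℕ) ≡ t
count-< {N = zero}  z≤n       = refl
count-< {N = suc N} z≤n       = count-< {N = N} z≤n
count-< {N = suc N} (s≤s t≤N) = cong suc (count-< t≤N)

count-≡ : ∀ {t N} → t < N → count {N} ((_≡ᵇ t) ∘ toℕ) ≡ 1
count-≡ {zero}  {suc N} _         = cong suc (count-empty N)
count-≡ {suc t} {suc N} (s≤s t<N) = count-≡ t<N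

-- Division by D identifies the numbers below `k * D` with pairs of a remainder below D and a
-- quotient below k, so one condition on each cuts out a rectangle. The induction splits off the
-- block of quotient 0.
count-blocks : ∀ D .{{_ : NonZero D}} (g h : ℕ → Bool) k →
  count {k * D} ((λ x → g (x % D) ∧ h (x / D)) ∘ toℕ) ≡ count {D} (g ∘ toℕ) * count {k} (h ∘ toℕ)
count-blocks D g h zero    = sym (*-zeroʳ (count {D} (g ∘ toℕ)))
count-blocks D g h (suc k) = begin
  count {D + k * D} (f ∘ toℕ)                                            ≡⟨ count-+ D f ⟩
  count {D} (f ∘ toℕ) + count {k * D} (f ∘ (D +_) ∘ toℕ)                 ≡⟨ cong₂ _+_ (count-cong {D} first) (count-cong {k * D} rest) ⟩
  count {D} (λ i → g (toℕ i) ∧ h 0) + count {k * D} ((λ x → g (x % D) ∧ h (suc (x / D))) ∘ toℕ)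
    ≡⟨ cong₂ _+_ (scale (h 0)) (count-blocks D g (h ∘ suc) k) ⟩
  G * bit (h 0) + G * count {k} (h ∘ suc ∘ toℕ)                          ≡⟨ *-distribˡ-+ G (bit (h 0)) _ ⟨
  G * (bit (h 0) + count {k} (h ∘ suc ∘ toℕ))                            ∎
  where
  open ≡-Reasoning
  f : ℕ → Bool
  f x = g (x % D) ∧ h (x / D)
  G = count {D} (g ∘ toℕ)
  first : ∀ (i : Fin D) → f (toℕ i) ≡ g (toℕ i) ∧ h 0
  first i = cong₂ (λ a b → g a ∧ h b) (m<n⇒m%n≡m (toℕ<n i)) (m<n⇒m/n≡0 (toℕ<n i))
  rest : ∀ (i : Fin (k * D)) → f (D + toℕ i) ≡ g (toℕ i % D) ∧ h (suc (toℕ i / D))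
  rest i = cong₂ (λ a b → g a ∧ h b)
    (trans (cong (_% D) (+-comm D (toℕ i))) ([m+n]%n≡m%n (toℕ i) D))
    (trans (+-distrib-/-∣ˡ (toℕ i) (∣-refl {D})) (cong (_+ toℕ i / D) (n/n≡1 D)))
  scale : ∀ b → count {D} (λ i → g (toℕ i) ∧ b) ≡ G * bit b
  scale true  = trans (count-cong {D} (λ i → ∧-identityʳ _)) (sym (*-identityʳ G))
  scale false = trans (count-cong {D} (λ i → ∧-zeroʳ _)) (trans (count-empty D) (sym (*-zeroʳ G)))

-- Isomorphisms of Cayley digraphs and powers under automorphisms

module _ (G : FiniteGroup) where
  open FiniteGroup G
  open GroupProperties group using (//-rightDividesˡ; //-rightDividesʳ)

  arc⇔quotient : ∀ S u v → Digraph.Arc (Cay G S) u v ⇔ (v ∙ u ⁻¹ ∈ S)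
  arc⇔quotient S u v = mk⇔
    (λ { (s , s∈S , refl) → subst (_∈ S) (sym (//-rightDividesʳ u s)) s∈S })
    (λ vu⁻¹∈S → v ∙ u ⁻¹ , vu⁻¹∈S , sym (//-rightDividesˡ u v))

  -- By `arc⇔quotient`, adjacency depends only on v u⁻¹, so a bijection matching the membership of
  -- these quotients is an isomorphism.
  cay-≅ : ∀ {U S} (φ ψ : Carrier → Carrier) → (∀ u → φ (ψ u) ≡ u) → (∀ u → ψ (φ u) ≡ u) →
          (∀ u v → (v ∙ u ⁻¹ ∈ U) ⇔ (φ v ∙ φ u ⁻¹ ∈ S)) → Cay G U ≅ Cay G S
  cay-≅ {U} {S} φ ψ φψ ψφ quotients = record
    { bijection = mk↔ₛ′ φ ψ φψ ψφ
    ; arcs      = λ u v → mk⇔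
        (from (arc⇔quotient S (φ u) (φ v)) ∘ to (quotients u v) ∘ to (arc⇔quotient U u v))
        (from (arc⇔quotient U u v) ∘ from (quotients u v) ∘ to (arc⇔quotient S (φ u) (φ v)))
    }
    where open Equivalence

  -- With a one-element connection set each vertex has a single out-neighbour, its left translate.
  -- It is therefore enough that `φ` conjugates translation by s to translation by t.
  cay-point-≅ : ∀ {U S} {s t : Carrier} (φ ψ : Carrier → Carrier) →
                (∀ u → φ (ψ u) ≡ u) → (∀ u → ψ (φ u) ≡ u) → (∀ u → φ (s ∙ u) ≡ t ∙ φ u) →
                (∀ g → g ∈ U ⇔ g ≡ s) → (∀ g → g ∈ S ⇔ g ≡ t) → Cay G U ≅ Cay G S
  cay-point-≅ {U} {S} {s} {t} φ ψ φψ ψφ shift U≡s S≡t = cay-≅ φ ψ φψ ψφ λ u v → mk⇔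
    (λ q∈U → from (S≡t _) (begin
      φ v ∙ φ u ⁻¹              ≡⟨ cong (λ x → φ x ∙ φ u ⁻¹) (//-rightDividesˡ u v) ⟨
      φ (v ∙ u ⁻¹ ∙ u) ∙ φ u ⁻¹ ≡⟨ cong (λ x → φ (x ∙ u) ∙ φ u ⁻¹) (to (U≡s _) q∈U) ⟩
      φ (s ∙ u) ∙ φ u ⁻¹        ≡⟨ cong (_∙ φ u ⁻¹) (shift u) ⟩
      t ∙ φ u ∙ φ u ⁻¹          ≡⟨ //-rightDividesʳ (φ u) t ⟩
      t                         ∎))
    (λ q∈S → from (U≡s _) (begin
      v ∙ u ⁻¹                           ≡⟨ cong (_∙ u ⁻¹) (ψφ v) ⟨
      ψ (φ v) ∙ u ⁻¹                     ≡⟨ cong (λ x → ψ x ∙ u ⁻¹) (//-rightDividesˡ (φ u) (φ v)) ⟨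
      ψ (φ v ∙ φ u ⁻¹ ∙ φ u) ∙ u ⁻¹      ≡⟨ cong (λ x → ψ (x ∙ φ u) ∙ u ⁻¹) (to (S≡t _) q∈S) ⟩
      ψ (t ∙ φ u) ∙ u ⁻¹                 ≡⟨ cong (λ x → ψ x ∙ u ⁻¹) (shift u) ⟨
      ψ (φ (s ∙ u)) ∙ u ⁻¹               ≡⟨ cong (_∙ u ⁻¹) (ψφ (s ∙ u)) ⟩
      s ∙ u ∙ u ⁻¹                       ≡⟨ //-rightDividesʳ u s ⟩
      s                                  ∎))
    where
    open Equivalence
    open ≡-Reasoning

  open RawMonoidDefs (Group.rawMonoid group) using () renaming (_×_ to pow)

  module _ {σ : Carrier → Carrier} (aut : IsAutomorphism G σ) where
    open IsGroupIsomorphism aut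

    aut-pow : ∀ k g → σ (pow k g) ≡ pow k (σ g)
    aut-pow zero    g = ε-homo
    aut-pow (suc k) g = trans (∙-homo g (pow k g)) (cong (σ g ∙_) (aut-pow k g))

    aut-pow-ε : ∀ k g → pow k (σ g) ≡ ε → pow k g ≡ ε
    aut-pow-ε k g eq = injective (trans (aut-pow k g) (trans eq (sym ε-homo)))

-- Arithmetic in ℤ/N and reduction modulo a divisor

module Residues (N : ℕ) .{{_ : NonZero N}} where
  open Cyclic N public
  private
    module A = AbelianGroup ⊕-abelianGroup
    module CS = CommutativeSemigroupProperties A.commutativeSemigroup
  open AbelianGroupProperties ⊕-abelianGroup public
    using () renaming
    ( inverseˡ-unique to ⊖-uniqueˡ; ⁻¹-∙-comm to ⊖-⊕-comm; ⁻¹-involutive to ⊖-involutive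
    ; ε⁻¹≈ε to ⊖-𝟎; ⁻¹-anti-homo‿- to ⊖-anti-⊝; x∙y⁻¹≈ε⇒x≈y to ⊝≡𝟎⇒≡
    ; ∙-cancelˡ to ⊕-cancelˡ
    ; //-rightDividesˡ to ⊝-⊕; //-rightDividesʳ to ⊕-⊝; xyx⁻¹≈y to i⊕j⊝i≡j )
  open A public using () renaming (identityʳ to ⊕-identityʳ; inverseʳ to ⊕-inverseʳ)
  open CS public using () renaming (xy∙z≈xz∙y to ⊕-swapʳ)

  infixl 6 _⊝_

  _⊝_ : Fin N → Fin N → Fin N
  i ⊝ j = i ⊕ ⊖ j

  i⊝[i⊝j]≡j : ∀ i j → i ⊝ (i ⊝ j) ≡ j
  i⊝[i⊝j]≡j i j = begin
    i ⊕ ⊖ (i ⊕ ⊖ j)  ≡⟨ cong (i ⊕_) (⊖-anti-⊝ i j) ⟩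
    i ⊕ (j ⊕ ⊖ i)    ≡⟨ ⊕-assoc i j (⊖ i) ⟨
    i ⊕ j ⊕ ⊖ i      ≡⟨ i⊕j⊝i≡j i j ⟩
    j                ∎
    where open ≡-Reasoning

  -- The map x ↦ k - x is a reflection. The vertex maps of both halves of the proof are built from
  -- such reflections.
  [k⊝i]⊝[k⊝j]≡j⊝i : ∀ k i j → (k ⊝ i) ⊝ (k ⊝ j) ≡ j ⊝ i
  [k⊝i]⊝[k⊝j]≡j⊝i k i j = begin
    (k ⊕ ⊖ i) ⊕ ⊖ (k ⊕ ⊖ j)  ≡⟨ ⊕-swapʳ k (⊖ i) _ ⟩
    k ⊝ (k ⊝ j) ⊕ ⊖ i        ≡⟨ cong (_⊝ i) (i⊝[i⊝j]≡j k j) ⟩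
    j ⊝ i                    ∎
    where open ≡-Reasoning

  mod-injective : ∀ {j k} → j mod N ≡ k mod N → j % N ≡ k % N
  mod-injective {j} {k} eq = trans (sym (toℕ-mod j)) (trans (cong toℕ eq) (toℕ-mod k))

  mod≢𝟎 : ∀ {k} → 0 < k → k < N → k mod N ≢ 𝟎
  mod≢𝟎 0<k k<N eq = <⇒≢ 0<k (sym (trans (sym (m<n⇒m%n≡m k<N))
    (trans (mod-injective eq) (m<n⇒m%n≡m (≤-trans 0<k (<⇒≤ k<N))))))

module Reduction {N D : ℕ} .{{_ : NonZero N}} .{{_ : NonZero D}} (D∣N : D ∣ N) where
  private
    module N = Residues N
    module D = Residues D

  ρ : Fin N → Fin D
  ρ i = toℕ i mod D

  ρ-mod : ∀ k → ρ (k mod N) ≡ k mod D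
  ρ-mod k = D.mod-cong (trans (cong (_% D) (N.toℕ-mod k)) (m∣n⇒o%n%m≡o%m D N k D∣N))

  ρ-⊕ : ∀ i j → ρ (i N.⊕ j) ≡ ρ i D.⊕ ρ j
  ρ-⊕ i j = trans (ρ-mod (toℕ i + toℕ j)) (sym (D.mod-homo-+ (toℕ i) (toℕ j)))

  ρ-⊖ : ∀ i → ρ (N.⊖ i) ≡ D.⊖ ρ i
  ρ-⊖ i = D.⊖-uniqueˡ (ρ (N.⊖ i)) (ρ i)
    (trans (sym (ρ-⊕ (N.⊖ i) i)) (trans (cong ρ (N.⊕-inverseˡ i)) (ρ-mod 0)))

  ρ-⊝ : ∀ i j → ρ (i N.⊝ j) ≡ ρ i D.⊝ ρ j
  ρ-⊝ i j = trans (ρ-⊕ i (N.⊖ j)) (cong (ρ i D.⊕_) (ρ-⊖ j))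

-- Powers and automorphisms of the dicyclic group

module DicyclicFacts (n : ℕ) .{{_ : NonZero n}} where
  open Dicyclic n public using (2n≢0; ν; ν⊕ν; ⊖ν; Element; _·_; _⁻¹; e; a; b; Q; ·-identityʳ)
  open Residues (2 * n) public
  open RawMonoidDefs (Group.rawMonoid (FiniteGroup.group Q)) public using () renaming (_×_ to pow)

  -- The left side is the exponent of a that the multiplication rule yields for (aᵏb)(aⁱb)⁻¹: the n
  -- in the inverse cancels the n coming from b².
  k⊝[i⊕ν]⊕ν : ∀ k i → k ⊕ ⊖ (i ⊕ ν) ⊕ ν ≡ k ⊝ i
  k⊝[i⊕ν]⊕ν k i = begin
    k ⊕ ⊖ (i ⊕ ν) ⊕ ν      ≡⟨ cong (λ x → k ⊕ x ⊕ ν) (⊖-⊕-comm i ν) ⟨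
    k ⊕ (⊖ i ⊕ ⊖ ν) ⊕ ν    ≡⟨ ⊕-assoc k _ ν ⟩
    k ⊕ (⊖ i ⊕ ⊖ ν ⊕ ν)    ≡⟨ cong (k ⊕_) (⊝-⊕ ν (⊖ i)) ⟩
    k ⊝ i                  ∎
    where open ≡-Reasoning

  pow-rotation : ∀ k i → pow k (i , 0F) ≡ ((k * toℕ i) mod (2 * n) , 0F)
  pow-rotation zero    i = refl
  pow-rotation (suc k) i = trans (cong ((i , 0F) ·_) (pow-rotation k i))
    (cong (_, 0F) (trans (cong (_⊕ (k * toℕ i) mod (2 * n)) (sym (mod-toℕ i)))
                         (mod-homo-+ (toℕ i) (k * toℕ i))))

  -- Whatever i is, aⁱb squares to aⁿ, whose square is trivial.
  reflection⁴ : ∀ i → pow 4 (i , 1F) ≡ e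
  reflection⁴ i = begin
    s · (s · (s · (s · e)))  ≡⟨ cong (λ x → s · (s · (s · x))) (·-identityʳ s) ⟩
    s · (s · (s · s))        ≡⟨ cong (λ x → s · (s · x)) s² ⟩
    s · (s · (ν , 0F))       ≡⟨ ·-assoc s s (ν , 0F) ⟨
    s · s · (ν , 0F)         ≡⟨ cong (_· (ν , 0F)) s² ⟩
    (ν ⊕ ν , 0F)             ≡⟨ cong (_, 0F) ν⊕ν ⟩
    e                        ∎
    where
    open ≡-Reasoning
    open Dicyclic n using (·-assoc)
    s = i , 1F
    s² : s · s ≡ (ν , 0F)
    s² = cong (_, 0F) (trans (cong (_⊕ ν) (⊕-inverseʳ i)) (⊕-identityˡ ν))

  -- Moving aᵏ past b inverts it, so commuting forces aᵏ = a⁻ᵏ.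
  commutes⇒² : ∀ i k → (k , 0F) · (i , 1F) ≡ (i , 1F) · (k , 0F) → pow 2 (k , 0F) ≡ e
  commutes⇒² i k eq = trans (cong ((k , 0F) ·_) (·-identityʳ (k , 0F)))
    (cong (_, 0F) (trans (cong (k ⊕_) k≡⊖k) (⊕-inverseʳ k)))
    where
    k≡⊖k : k ≡ ⊖ k
    k≡⊖k = ⊕-cancelˡ i k (⊖ k) (trans (⊕-comm i k) (cong proj₁ eq))

  pow-a≢e : ∀ {k} → 0 < k → k < 2 * n → pow k a ≢ e
  pow-a≢e {k} 0<k k<2n eq = mod≢𝟎 0<k k<2n (cong proj₁ (trans (sym (Presentation.pow-a n k)) eq))

  module _ (3≤n : 3 ≤ n) where
    private
      4<2n : 4 < 2 * n
      4<2n = ≤-trans (s≤s (s≤s (s≤s (s≤s (s≤s z≤n))))) (*-monoʳ-≤ 2 3≤n)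
      2<2n : 2 < 2 * n
      2<2n = ≤-trans (s≤s (s≤s (s≤s z≤n))) 4<2n

    -- If σ a = aᵏb, then a⁴ = e. If σ a = aᵏ, then aᵏ commutes with the image aⁱb of aˢ, because a
    -- commutes with aˢ, and so a² = e. Since 2n > 4, the order of a excludes both.
    rotation-invariant : ∀ {σ} → IsAutomorphism Q σ → ∀ s i → σ (s , 0F) ≢ (i , 1F)
    rotation-invariant {σ} aut s i σs with σ a in σa
    ... | (k , 1F) = pow-a≢e (s≤s z≤n) 4<2n
                       (aut-pow-ε Q aut 4 a (trans (cong (pow 4) σa) (reflection⁴ k)))
    ... | (k , 0F) = pow-a≢e (s≤s z≤n) 2<2n
                       (aut-pow-ε Q aut 2 a (trans (cong (pow 2) σa) (commutes⇒² i k (begin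
      (k , 0F) · (i , 1F)    ≡⟨ cong₂ _·_ σa σs ⟨
      σ a · σ (s , 0F)       ≡⟨ ∙-homo a (s , 0F) ⟨
      σ (a · (s , 0F))       ≡⟨ cong (λ x → σ (x , 0F)) (⊕-comm _ s) ⟩
      σ ((s , 0F) · a)       ≡⟨ ∙-homo (s , 0F) a ⟩
      σ (s , 0F) · σ a       ≡⟨ cong₂ _·_ σs σa ⟩
      (i , 1F) · (k , 0F)    ∎))))
      where
      open ≡-Reasoning
      open IsGroupIsomorphism aut

-- Even n: connection sets inside ⟨a⟩

rotations : ∀ {N} → Subset (Fin N) → Subset (Fin N × Fin 2)
rotations S₀ (i , 0F) = S₀ i
rotations S₀ (i , 1F) = false

hasSize-rotations : ∀ {N} (S₀ : Subset (Fin N)) → HasSize (rotations S₀) (count S₀)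
hasSize-rotations {N} S₀ = subst (HasSize (rotations S₀))
  (trans (cong (count S₀ +_) (count-empty N)) (+-identityʳ _)) (hasSize-sheets (rotations S₀))

module EvenCase (n : ℕ) .{{_ : NonZero n}} (k : ℕ) .{{_ : NonZero k}} (n≡k*2 : n ≡ k * 2) (3≤n : 3 ≤ n) where

  open DicyclicFacts n

  -- No automorphism takes a set inside ⟨a⟩ onto one that contains aⁱb. Every valency for even n is
  -- refuted through this lemma.
  rotationSet-notDCI : ∀ S₀ U i → 𝟎 ∉ S₀ → e ∉ U → (i , 1F) ∈ U → Cay Q U ≅ Cay Q (rotations S₀) →
                       ¬ HasDCI Q (count S₀)
  rotationSet-notDCI S₀ U i 𝟎∉S₀ e∉U i∈U iso dci =
    absurd (Equivalence.to (image (i , 1F)) i∈U)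
    where
    ci = dci (rotations S₀) 𝟎∉S₀ (hasSize-rotations S₀) U e∉U iso
    σ = proj₁ ci
    aut = proj₁ (proj₂ ci)
    image = proj₂ (proj₂ ci)
    absurd : ¬ (∃ λ g → g ∈ rotations S₀ × σ g ≡ (i , 1F))
    absurd ((s , 1F) , () , _)
    absurd ((s , 0F) , _ , σs) = rotation-invariant 3≤n aut s i σs

  n<2n : n < 2 * n
  n<2n = m<m+n n (≤-trans (≤-trans (s≤s z≤n) 3≤n) (m≤m+n n 0))

  ν≢𝟎 : ν ≢ 𝟎
  ν≢𝟎 = mod≢𝟎 (≤-trans (s≤s z≤n) 3≤n) n<2n

  one : Fin (2 * n)
  one = 1 mod (2 * n)

  private
    module Parity = Reduction {2 * n} {2} (m∣m*n n)
    module Z₂ = Cyclic 2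

  par : Fin (2 * n) → Fin 2
  par = Parity.ρ

  -- Evenness of n makes aⁱbʲ ↦ i mod 2 a homomorphism with kernel ⟨a², b⟩, and it lets `τ` preserve
  -- parity.
  par-ν : par ν ≡ 0F
  par-ν = trans (Parity.ρ-mod n) (Z₂.mod-cong {n} {0} (trans (cong (_% 2) n≡k*2) (m*n%n≡0 k 2)))

  par-one : par one ≡ 1F
  par-one = Parity.ρ-mod 1

  par-𝟎 : par 𝟎 ≡ 0F
  par-𝟎 = Parity.ρ-mod 0

  par-⊖ : ∀ i → par (⊖ i) ≡ par i
  par-⊖ i = trans (Parity.ρ-⊖ i) (self (par i))
    where
    self : ∀ p → Z₂.⊖ p ≡ p
    self 0F = refl
    self 1F = refl

  par-⊝ : ∀ i j → par (i ⊝ j) ≡ par i Z₂.⊕ par j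
  par-⊝ i j = trans (Parity.ρ-⊕ i (⊖ j)) (cong (par i Z₂.⊕_) (par-⊖ j))

  par-⊕ν : ∀ i → par (i ⊕ ν) ≡ par i
  par-⊕ν i = trans (Parity.ρ-⊕ i ν) (trans (cong (par i Z₂.⊕_) par-ν) (Residues.⊕-identityʳ 2 (par i)))

  par-ν⊝ : ∀ i → par (ν ⊝ i) ≡ par i
  par-ν⊝ i = trans (cong par (⊕-comm ν (⊖ i))) (trans (par-⊕ν (⊖ i)) (par-⊖ i))

  mirror : Fin 2 → Fin (2 * n) → Fin (2 * n)
  mirror 0F i = ⊖ i
  mirror 1F i = ν ⊝ i

  par-mirror : ∀ p i → par (mirror p i) ≡ par i
  par-mirror 0F i = par-⊖ i
  par-mirror 1F i = par-ν⊝ i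

  mirror-involutive : ∀ p i → mirror p (mirror p i) ≡ i
  mirror-involutive 0F i = ⊖-involutive i
  mirror-involutive 1F i = i⊝[i⊝j]≡j ν i

  τ : Fin (2 * n) → Fin (2 * n)
  τ i = mirror (par i) i

  τ-even : ∀ i → par i ≡ 0F → τ i ≡ ⊖ i
  τ-even i eq = cong (λ p → mirror p i) eq

  τ-odd : ∀ i → par i ≡ 1F → τ i ≡ ν ⊝ i
  τ-odd i eq = cong (λ p → mirror p i) eq

  τ-involutive : ∀ i → τ (τ i) ≡ i
  τ-involutive i = trans (cong (λ p → mirror p (τ i)) (par-mirror (par i) i))
                         (mirror-involutive (par i) i)

  flip : Fin 2 → Fin (2 * n) → Fin (2 * n)
  flip 0F i = i
  flip 1F i = one ⊝ i

  flip-involutive : ∀ l i → flip l (flip l i) ≡ i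
  flip-involutive 0F i = refl
  flip-involutive 1F i = i⊝[i⊝j]≡j one i

  par-flip : ∀ l i → par (flip l i) ≡ par i Z₂.⊕ l
  par-flip 0F i = sym (Residues.⊕-identityʳ 2 (par i))
  par-flip 1F i = trans (par-⊝ one i) (trans (cong (Z₂._⊕ par i) par-one) (Z₂.⊕-comm 1F (par i)))

  -- The reflection x ↦ 1 − x (twisted by ν on odd x) together with x ↦ x + 2
  -- generates a regular dicyclic group of automorphisms of Cay(⟨a⟩, S₀).
  module Mirrored (S₀ : Subset (Fin (2 * n))) (closed : Closed τ S₀)
           (𝟎∉S₀ : 𝟎 ∉ S₀) (one∈S₀ : one ∈ S₀) where

    -- This is the preimage of `rotations S₀` under `φ`. Its elements have even exponent of a, so
    -- they lie in ⟨a², b⟩.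
    U : Subset Element
    U (i , l) = does (par i ≟ 0F) ∧ S₀ (flip l i)

    -- The elements with even i form ⟨a², b⟩, those with odd i its other coset. `φ` lays each of the
    -- two cosets onto one copy of ℤ/2n, named by the parity of i. `ψ` recovers l from par (flip l
    -- i) = par i + l.
    φ ψ : Element → Element
    φ (i , l) = flip l i , par i
    ψ (x , p) = flip (par x Z₂.⊕ p) x , par x Z₂.⊕ p

    cancel₂ : ∀ p q → p Z₂.⊕ (p Z₂.⊕ q) ≡ q
    cancel₂ 0F 0F = refl
    cancel₂ 0F 1F = refl
    cancel₂ 1F 0F = refl
    cancel₂ 1F 1F = refl

    φψ : ∀ u → φ (ψ u) ≡ u
    φψ (x , p) = cong₂ _,_ (flip-involutive (par x Z₂.⊕ p) x)
      (trans (par-flip (par x Z₂.⊕ p) x) (cancel₂ (par x) p))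

    ψφ : ∀ u → ψ (φ u) ≡ u
    ψφ (i , l) = trans (cong (λ q → flip q (flip l i) , q) δ≡l) (cong (_, l) (flip-involutive l i))
      where
      δ≡l : par (flip l i) Z₂.⊕ par i ≡ l
      δ≡l = trans (cong (Z₂._⊕ par i) (par-flip l i))
                  (trans (Z₂.⊕-comm (par i Z₂.⊕ l) (par i)) (cancel₂ (par i) l))

    closed⇔ : ∀ i j → τ i ≡ j → i ∈ S₀ ⇔ j ∈ S₀
    closed⇔ i j refl = mk⇔ (closed i) (λ t → subst (_∈ S₀) (τ-involutive i) (closed (τ i) t))

    ≡⇔ : ∀ i j → i ≡ j → i ∈ S₀ ⇔ j ∈ S₀
    ≡⇔ i j refl = mk⇔ id id

    rotation-quotient : ∀ x y p q → (x , q) · (y , p) ⁻¹ ∈ rotations S₀ ⇔ (p ≡ q × x ⊝ y ∈ S₀)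
    rotation-quotient x y 0F 0F = mk⇔ (refl ,_) proj₂
    rotation-quotient x y 0F 1F = mk⇔ (λ ()) (λ ())
    rotation-quotient x y 1F 0F = mk⇔ (λ ()) (λ ())
    rotation-quotient x y 1F 1F = mk⇔
      (λ t → refl , subst (_∈ S₀) (k⊝[i⊕ν]⊕ν x y) t)
      (λ { (_ , t) → subst (_∈ S₀) (sym (k⊝[i⊕ν]⊕ν x y)) t })

    ⊕₂≡0⇔ : ∀ p q → q Z₂.⊕ p ≡ 0F ⇔ p ≡ q
    ⊕₂≡0⇔ 0F 0F = mk⇔ id id
    ⊕₂≡0⇔ 1F 1F = mk⇔ (λ _ → refl) (λ _ → refl)
    ⊕₂≡0⇔ 0F 1F = mk⇔ (λ ()) (λ ())
    ⊕₂≡0⇔ 1F 0F = mk⇔ (λ ()) (λ ())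

    -- Both memberships force the exponents of u and v to have equal parity. What remains is one
    -- equivalence inside S₀, needed only under that equality.
    transfer : ∀ i k l z x y → par z ≡ par k Z₂.⊕ par i →
               (par i ≡ par k → flip l z ∈ S₀ ⇔ x ⊝ y ∈ S₀) →
               (z , l) ∈ U ⇔ ((x , par k) · (y , par i) ⁻¹ ∈ rotations S₀)
    transfer i k l z x y par-z same = mk⇔
      (λ t → let even , t′ = to T-∧ t
                 p≡q = to (⊕₂≡0⇔ (par i) (par k)) (trans (sym par-z) (point⇒≡ (par z) 0F even))
             in from (rotation-quotient x y (par i) (par k)) (p≡q , to (same p≡q) t′))
      (λ t → let p≡q , t′ = to (rotation-quotient x y (par i) (par k)) t
                 z-even = trans par-z (from (⊕₂≡0⇔ (par i) (par k)) p≡q)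
             in from T-∧ (subst (λ p → T (does (p ≟ 0F))) (sym z-even) _ , from (same p≡q) t′))
      where open Equivalence

    quotients : ∀ u v → (v · u ⁻¹ ∈ U) ⇔ (φ v · φ u ⁻¹ ∈ rotations S₀)
    quotients (i , 0F) (k , 0F) = transfer i k 0F (k ⊝ i) k i (par-⊝ k i) (λ _ → ≡⇔ (k ⊝ i) (k ⊝ i) refl)
    quotients (i , 0F) (k , 1F) = transfer i k 1F (k ⊝ ⊖ i) (one ⊝ k) i
      (trans (par-⊝ k (⊖ i)) (cong (par k Z₂.⊕_) (par-⊖ i)))
      (λ _ → ≡⇔ (one ⊝ (k ⊝ ⊖ i)) (one ⊝ k ⊝ i) (begin
        one ⊝ (k ⊝ ⊖ i)          ≡⟨ cong (λ x → one ⊝ (k ⊕ x)) (⊖-involutive i) ⟩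
        one ⊝ (k ⊕ i)            ≡⟨ cong (one ⊕_) (⊖-⊕-comm k i) ⟨
        one ⊕ (⊖ k ⊕ ⊖ i)        ≡⟨ ⊕-assoc one (⊖ k) (⊖ i) ⟨
        one ⊝ k ⊝ i              ∎))
      where open ≡-Reasoning
    quotients (i , 1F) (k , 0F) = transfer i k 1F (k ⊕ (i ⊕ ν)) k (one ⊝ i)
      (trans (Parity.ρ-⊕ k (i ⊕ ν)) (cong (par k Z₂.⊕_) (par-⊕ν i)))
      -- Closure is applied to an odd element: 1 - (k + i + n) goes to k - (1 - i), the n in `τ`
      -- cancelling the n from the inverse of aⁱb.
      (λ p≡q → closed⇔ (one ⊝ (k ⊕ (i ⊕ ν))) (k ⊝ (one ⊝ i)) (trans (τ-odd (one ⊝ (k ⊕ (i ⊕ ν))) (odd p≡q)) (begin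
        ν ⊝ (one ⊝ (k ⊕ (i ⊕ ν)))            ≡⟨ cong (ν ⊕_) (⊖-anti-⊝ one _) ⟩
        ν ⊕ (k ⊕ (i ⊕ ν) ⊝ one)              ≡⟨ cong (λ x → ν ⊕ (x ⊝ one)) (⊕-assoc k i ν) ⟨
        ν ⊕ (k ⊕ i ⊕ ν ⊝ one)                ≡⟨ cong (ν ⊕_) (⊕-swapʳ (k ⊕ i) ν (⊖ one)) ⟩
        ν ⊕ (k ⊕ i ⊝ one ⊕ ν)                ≡⟨ ⊕-comm ν _ ⟩
        k ⊕ i ⊝ one ⊕ ν ⊕ ν                  ≡⟨ ⊕-assoc _ ν ν ⟩
        k ⊕ i ⊝ one ⊕ (ν ⊕ ν)                ≡⟨ cong (k ⊕ i ⊝ one ⊕_) ν⊕ν ⟩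
        k ⊕ i ⊝ one ⊕ 𝟎                      ≡⟨ ⊕-identityʳ _ ⟩
        k ⊕ i ⊝ one                          ≡⟨ ⊕-assoc k i (⊖ one) ⟩
        k ⊕ (i ⊝ one)                        ≡⟨ cong (k ⊕_) (⊖-anti-⊝ one i) ⟨
        k ⊝ (one ⊝ i)                        ∎)))
      where
      open ≡-Reasoning
      double : ∀ p → p Z₂.⊕ p ≡ 0F
      double 0F = refl
      double 1F = refl
      odd : par i ≡ par k → par (one ⊝ (k ⊕ (i ⊕ ν))) ≡ 1F
      odd p≡q = begin
        par (one ⊝ (k ⊕ (i ⊕ ν)))            ≡⟨ par-⊝ one (k ⊕ (i ⊕ ν)) ⟩
        par one Z₂.⊕ par (k ⊕ (i ⊕ ν))       ≡⟨ cong₂ Z₂._⊕_ par-one (Parity.ρ-⊕ k (i ⊕ ν)) ⟩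
        1F Z₂.⊕ (par k Z₂.⊕ par (i ⊕ ν))     ≡⟨ cong (λ p → 1F Z₂.⊕ (par k Z₂.⊕ p)) (trans (par-⊕ν i) p≡q) ⟩
        1F Z₂.⊕ (par k Z₂.⊕ par k)           ≡⟨ cong (1F Z₂.⊕_) (double (par k)) ⟩
        1F                                   ∎
    quotients (i , 1F) (k , 1F) = transfer i k 0F (k ⊕ ⊖ (i ⊕ ν) ⊕ ν) (one ⊝ k) (one ⊝ i)
      (trans (cong par (k⊝[i⊕ν]⊕ν k i)) (par-⊝ k i))
      -- Closure is applied to the even element k - i: its negative is the difference left after
      -- reflecting both exponents by x ↦ 1 - x.
      (λ p≡q → closed⇔ (k ⊕ ⊖ (i ⊕ ν) ⊕ ν) ((one ⊝ k) ⊝ (one ⊝ i))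
        (trans (τ-even (k ⊕ ⊖ (i ⊕ ν) ⊕ ν) (trans (trans (cong par (k⊝[i⊕ν]⊕ν k i)) (par-⊝ k i))
                                             (Equivalence.from (⊕₂≡0⇔ (par i) (par k)) p≡q)))
        (begin
        ⊖ (k ⊕ ⊖ (i ⊕ ν) ⊕ ν)     ≡⟨ cong ⊖_ (k⊝[i⊕ν]⊕ν k i) ⟩
        ⊖ (k ⊝ i)                 ≡⟨ ⊖-anti-⊝ k i ⟩
        i ⊝ k                     ≡⟨ [k⊝i]⊝[k⊝j]≡j⊝i one k i ⟨
        (one ⊝ k) ⊝ (one ⊝ i)     ∎)))
      where open ≡-Reasoning

    closed-notDCI : ¬ HasDCI Q (count S₀)
    -- The witness outside ⟨a⟩ is b: it lies in `U` because `flip` sends 0 to 1, which is in S₀.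
    closed-notDCI = rotationSet-notDCI S₀ U 𝟎 𝟎∉S₀
      (λ t → 𝟎∉S₀ (proj₂ (Equivalence.to T-∧ t)))
      (Equivalence.from T-∧
        ( subst (λ p → T (does (p ≟ 0F))) (sym par-𝟎) _
        , subst (_∈ S₀) (sym (trans (cong (one ⊕_) ⊖-𝟎) (⊕-identityʳ one))) one∈S₀))
      (cay-≅ Q φ ψ φψ ψφ quotients)

  -- Even n: closed sets of every size from 2 to 2n - 1

  τ-𝟎 : τ 𝟎 ≡ 𝟎
  τ-𝟎 = trans (τ-even 𝟎 par-𝟎) ⊖-𝟎

  τ-ν : τ ν ≡ ν
  τ-ν = trans (τ-even ν par-ν) ⊖ν

  par-τone : par (τ one) ≡ 1F
  par-τone = trans (par-mirror (par one) one) par-one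

  odd≢even : ∀ i j → par i ≡ 1F → par j ≡ 0F → i ≢ j
  odd≢even i j odd even refl with () ← trans (sym odd) even

  -- `τ one` is n - 1, and n - 1 = 1 modulo 2n would give n = 2.
  τone≢one : τ one ≢ one
  τone≢one eq = <⇒≢ 3≤n (sym (begin
    n              ≡⟨ m<n⇒m%n≡m n<2n ⟨
    n % (2 * n)    ≡⟨ mod-injective {n} {2} ν≡2 ⟩
    2 % (2 * n)    ≡⟨ m<n⇒m%n≡m (≤-trans 3≤n (<⇒≤ n<2n)) ⟩
    2              ∎))
    where
    open ≡-Reasoning
    ν≡2 : ν ≡ 2 mod (2 * n)
    ν≡2 = begin
      ν                  ≡⟨ ⊝-⊕ one ν ⟨
      ν ⊝ one ⊕ one      ≡⟨ cong (_⊕ one) (trans (sym (τ-odd one par-one)) eq) ⟩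
      one ⊕ one          ≡⟨ mod-homo-+ 1 1 ⟩
      2 mod (2 * n)      ∎

  -- The orbit {1, n - 1} is put in by hand. From the residues other than 0, n, 1 and n - 1,
  -- `closedSubset` supplies t or t - 1 more. In the second case the fixed point n, kept in reserve,
  -- is added.
  closedSet : ∀ t → t ≤ 2 * n ∸ 3 →
    ∃ λ S₀ → Closed τ S₀ × 𝟎 ∉ S₀ × one ∈ S₀ × count S₀ ≡ 2 + t
  closedSet t t≤ = build (closedSubset τ τ-involutive f₃ closed₃ t (≤-trans t≤ (≤-reflexive size)))
    where
    f₀ f₁ f₂ f₃ : Subset (Fin (2 * n))
    f₀ _ = true
    f₁ = f₀ ∖ 𝟎
    f₂ = f₁ ∖ ν
    f₃ = f₂ ∖ one ∖ τ one

    closed₃ : Closed τ f₃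
    closed₃ = removeOrbit τ τ-involutive f₂
      (removeFixed τ τ-involutive f₁ (removeFixed τ τ-involutive f₀ (λ _ _ → _) 𝟎 τ-𝟎) ν τ-ν) one

    odd∈f₂ : ∀ i → par i ≡ 1F → i ∈ f₂
    odd∈f₂ i odd = ⇒∖ f₁ ν i (⇒∖ f₀ 𝟎 i _ (odd≢even i 𝟎 odd par-𝟎)) (odd≢even i ν odd par-ν)

    -- The bound on t exceeds the size of `f₃` by the one that `closedSubset` permits.
    size : 2 * n ∸ 3 ≡ suc (count f₃)
    size = cong (_∸ 3) (begin
      2 * n                          ≡⟨ count-full (2 * n) ⟨
      count f₀                       ≡⟨ count-∖ f₀ 𝟎 _ ⟩
      1 + count f₁                   ≡⟨ cong suc (count-∖ f₁ ν (⇒∖ f₀ 𝟎 ν _ ν≢𝟎)) ⟩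
      2 + count f₂                   ≡⟨ cong (2 +_) (count-∖ f₂ one (odd∈f₂ one par-one)) ⟩
      3 + count (f₂ ∖ one)           ≡⟨ cong (3 +_) (count-∖ (f₂ ∖ one) (τ one) (⇒∖ f₂ one (τ one) (odd∈f₂ (τ one) par-τone) τone≢one)) ⟩
      4 + count f₃                   ∎)
      where open ≡-Reasoning

    build : (∃ λ g → Closed τ g × (∀ i → i ∈ g → i ∈ f₃) × (count g ≡ t ⊎ suc (count g) ≡ t)) →
      ∃ λ S₀ → Closed τ S₀ × 𝟎 ∉ S₀ × one ∈ S₀ × count S₀ ≡ 2 + t
    build (g , closed , g⊆f₃ , size) = finish size
      where
      g⊆f₂∖one : ∀ i → i ∈ g → i ∈ f₂ ∖ one
      g⊆f₂∖one i = proj₁ ∘ ∖⇒ (f₂ ∖ one) (τ one) i ∘ g⊆f₃ i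
      g⊆f₂ : ∀ i → i ∈ g → i ∈ f₂
      g⊆f₂ i = proj₁ ∘ ∖⇒ f₂ one i ∘ g⊆f₂∖one i
      𝟎∉g : 𝟎 ∉ g
      𝟎∉g t = proj₂ (∖⇒ f₀ 𝟎 𝟎 (proj₁ (∖⇒ f₁ ν 𝟎 (g⊆f₂ 𝟎 t)))) refl
      ν∉g : ν ∉ g
      ν∉g t = proj₂ (∖⇒ f₁ ν ν (g⊆f₂ ν t)) refl
      one∉g : one ∉ g
      one∉g t = proj₂ (∖⇒ f₂ one one (g⊆f₂∖one one t)) refl
      τone∉g : τ one ∉ g
      τone∉g t = proj₂ (∖⇒ (f₂ ∖ one) (τ one) (τ one) (g⊆f₃ (τ one) t)) refl

      h : Subset (Fin (2 * n))
      h = one ◂ τ one ◂ g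
      h-closed : Closed τ h
      h-closed = insertOrbit τ τ-involutive g closed one
      even∉h : ∀ i → par i ≡ 0F → i ∉ g → i ∉ h
      even∉h i even i∉g t with ◂⇒ one (τ one ◂ g) i t
      ... | inj₁ i≡one = odd≢even one i par-one even (sym i≡one)
      ... | inj₂ t′ with ◂⇒ (τ one) g i t′
      ...   | inj₁ i≡τone = odd≢even (τ one) i par-τone even (sym i≡τone)
      ...   | inj₂ i∈g    = i∉g i∈g
      one∈h : one ∈ h
      one∈h = ◂-head one (τ one ◂ g) one refl
      one∉ : one ∉ τ one ◂ g
      one∉ t with ◂⇒ (τ one) g one t
      ... | inj₁ eq = τone≢one (sym eq)
      ... | inj₂ t′ = one∉g t′
      count-h : count h ≡ 2 + count g
      count-h = trans (count-◂ one (τ one ◂ g) one∉) (cong suc (count-◂ (τ one) g τone∉g))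

      finish : count g ≡ t ⊎ suc (count g) ≡ t →
        ∃ λ S₀ → Closed τ S₀ × 𝟎 ∉ S₀ × one ∈ S₀ × count S₀ ≡ 2 + t
      finish (inj₁ eq) = h , h-closed , even∉h 𝟎 par-𝟎 𝟎∉g , one∈h , trans count-h (cong (2 +_) eq)
      finish (inj₂ eq) = ν ◂ h , insertFixed τ τ-involutive h h-closed ν τ-ν
        , 𝟎∉ , ◂-tail ν h one one∈h
        , trans (count-◂ ν h (even∉h ν par-ν ν∉g)) (trans (cong suc count-h) (cong (2 +_) eq))
        where
        𝟎∉ : 𝟎 ∉ ν ◂ h
        𝟎∉ t with ◂⇒ ν h 𝟎 t
        ... | inj₁ eq = ν≢𝟎 (sym eq)
        ... | inj₂ t′ = even∉h 𝟎 par-𝟎 𝟎∉g t′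

  notDCI-≥2 : ∀ m → 2 ≤ m → m ≤ 2 * n ∸ 1 → ¬ HasDCI Q m
  notDCI-≥2 (suc (suc t)) (s≤s (s≤s _)) m≤ =
    let S₀ , closed , 𝟎∉S₀ , one∈S₀ , size = closedSet t (t≤ (2 * n) m≤)
    in subst (λ m → ¬ HasDCI Q m) size (Mirrored.closed-notDCI S₀ closed 𝟎∉S₀ one∈S₀)
    where
    t≤ : ∀ N → 2 + t ≤ N ∸ 1 → t ≤ N ∸ 3
    t≤ (suc (suc (suc N))) (s≤s (s≤s t≤N)) = t≤N

  -- Even n: valency one

  κ : Fin (2 * n)
  κ = k mod (2 * n)

  2n≡4k : 2 * n ≡ 4 * k
  2n≡4k = trans (cong (2 *_) (trans n≡k*2 (*-comm k 2))) (sym (*-assoc 2 2 k))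

  κ⊕κ : κ ⊕ κ ≡ ν
  κ⊕κ = trans (mod-homo-+ k k) (cong (_mod (2 * n)) (trans (cong (k +_) (sym (+-identityʳ k))) (trans (*-comm 2 k) (sym n≡k*2))))

  instance
    4k≢0 : NonZero (4 * k)
    4k≢0 = m*n≢0 4 k

  other : Fin 2 → Fin 2
  other 0F = 1F
  other 1F = 0F

  other-involutive : ∀ p → other (other p) ≡ p
  other-involutive 0F = refl
  other-involutive 1F = refl

  -- Left multiplications by b and by a^(n/2) both split the group into 4-cycles. A two-colouring
  -- `digit` of ℤ/2n that changes under adding n/2 provides a bijection matching the cycles.
  module FourCycles (digit : Fin (2 * n) → Fin 2) (digit-⊕κ : ∀ i → digit (i ⊕ κ) ≡ other (digit i)) where

    digit-⊕ν : ∀ i → digit (i ⊕ ν) ≡ digit i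
    digit-⊕ν i = begin
      digit (i ⊕ ν)                ≡⟨ cong (λ x → digit (i ⊕ x)) κ⊕κ ⟨
      digit (i ⊕ (κ ⊕ κ))          ≡⟨ cong digit (⊕-assoc i κ κ) ⟨
      digit (i ⊕ κ ⊕ κ)            ≡⟨ digit-⊕κ (i ⊕ κ) ⟩
      other (digit (i ⊕ κ))        ≡⟨ cong other (digit-⊕κ i) ⟩
      other (other (digit i))      ≡⟨ other-involutive (digit i) ⟩
      digit i                      ∎
      where open ≡-Reasoning

    digit-⊝κ : ∀ i → digit (i ⊝ κ) ≡ other (digit i)
    digit-⊝κ i = trans (sym (other-involutive _))
      (cong other (trans (sym (digit-⊕κ (i ⊝ κ))) (cong digit (⊝-⊕ κ i))))

    weight : Fin 2 → Fin (2 * n)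
    weight 0F = 𝟎
    weight 1F = κ

    base : Fin (2 * n) → Fin (2 * n)
    base i = i ⊝ weight (digit i)

    digit-⊝weight : ∀ i d → digit i ≡ d → digit (i ⊝ weight d) ≡ 0F
    digit-⊝weight i 0F eq = trans (cong digit (trans (cong (i ⊕_) ⊖-𝟎) (⊕-identityʳ i))) eq
    digit-⊝weight i 1F eq = trans (digit-⊝κ i) (cong other eq)

    digit-base : ∀ i → digit (base i) ≡ 0F
    digit-base i = digit-⊝weight i (digit i) refl

    digit-⊕weight : ∀ i → digit i ≡ 0F → ∀ c → digit (i ⊕ weight c) ≡ c
    digit-⊕weight i eq 0F = trans (cong digit (⊕-identityʳ i)) eq
    digit-⊕weight i eq 1F = trans (digit-⊕κ i) (cong other eq)

    base-⊕weight : ∀ i → digit i ≡ 0F → ∀ c → base (i ⊕ weight c) ≡ i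
    base-⊕weight i eq c = trans (cong (λ d → i ⊕ weight c ⊝ weight d) (digit-⊕weight i eq c))
                                  (⊕-⊝ (weight c) i)

    signed : Fin 2 → Fin (2 * n) → Fin (2 * n)
    signed 0F i = i
    signed 1F i = ⊖ i

    signed-involutive : ∀ l i → signed l (signed l i) ≡ i
    signed-involutive 0F i = refl
    signed-involutive 1F i = ⊖-involutive i

    -- The coordinates trade roles: the colour of the exponent of a becomes the exponent of b, and
    -- the exponent of b becomes the colour, encoded by adding 0 or n/2 to a base of colour 0.
    -- `signed` undoes the inversion in baⁱ = a⁻ⁱb.
    Φ : Element → Element
    Φ (i , l) = base (signed l i) ⊕ weight l , digit (signed l i)

    Ψ : Element → Element
    Ψ (x , c) = signed (digit x) (base x ⊕ weight c) , digit x

    ΦΨ : ∀ u → Φ (Ψ u) ≡ u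
    ΦΨ (x , c) = trans
      (cong (λ y → base y ⊕ weight (digit x) , digit y) (signed-involutive (digit x) (base x ⊕ weight c)))
      (cong₂ _,_
        (trans (cong (_⊕ weight (digit x)) (base-⊕weight (base x) (digit-base x) c)) (⊝-⊕ (weight (digit x)) x))
        (digit-⊕weight (base x) (digit-base x) c))

    ΨΦ : ∀ u → Ψ (Φ u) ≡ u
    ΨΦ (i , l) = trans
      (cong₂ (λ y d → signed d (y ⊕ weight (digit j)) , d) (base-⊕weight (base j) (digit-base j) l) (digit-⊕weight (base j) (digit-base j) l))
      (cong (_, l) (trans (cong (signed l) (⊝-⊕ (weight (digit j)) j)) (signed-involutive l i)))
      where
      j = signed l i

    -- The cycle of b through aⁱ is aⁱ, a⁻ⁱb, aⁱ⁺ⁿ, a⁻ⁱ⁺ⁿb. A step from ⟨a⟩ raises the weight from 0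
    -- to n/2; a step back into ⟨a⟩ resets the weight and moves the base by n, again a total of n/2.
    Φ-shift : ∀ u → Φ (b · u) ≡ (κ , 0F) · Φ u
    Φ-shift (i , 0F) = trans
      (cong (λ x → base x ⊕ κ , digit x) (trans (cong ⊖_ (⊕-identityˡ (⊖ i))) (⊖-involutive i)))
      (cong (_, digit i) (trans (⊕-comm (base i) κ) (cong (κ ⊕_) (sym (⊕-identityʳ (base i))))))
    Φ-shift (i , 1F) = trans
      (cong (λ x → base (x ⊕ ν) ⊕ 𝟎 , digit (x ⊕ ν)) (⊕-identityˡ (⊖ i)))
      (cong₂ _,_ (begin
        base (j ⊕ ν) ⊕ 𝟎                    ≡⟨ ⊕-identityʳ _ ⟩
        base (j ⊕ ν)                        ≡⟨ cong (λ d → j ⊕ ν ⊝ weight d) (digit-⊕ν j) ⟩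
        j ⊕ ν ⊝ weight (digit j)            ≡⟨ ⊕-swapʳ j ν _ ⟩
        base j ⊕ ν                          ≡⟨ cong (base j ⊕_) κ⊕κ ⟨
        base j ⊕ (κ ⊕ κ)                    ≡⟨ ⊕-assoc (base j) κ κ ⟨
        base j ⊕ κ ⊕ κ                      ≡⟨ ⊕-comm _ κ ⟩
        κ ⊕ (base j ⊕ κ)                    ∎)
        (digit-⊕ν j))
      where
      open ≡-Reasoning
      j = ⊖ i

  digit : Fin (2 * n) → Fin 2
  digit i = (toℕ i / k) mod 2

  -- Since 2n = 4k, reduction modulo 2n changes the quotient by k by a multiple of 4, so adding k
  -- flips its parity even across the wrap-around.
  digit-⊕κ : ∀ i → digit (i ⊕ κ) ≡ other (digit i)
  digit-⊕κ i = begin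
    (toℕ (i ⊕ κ) / k) mod 2                 ≡⟨ cong (λ x → (x / k) mod 2) toℕ-i⊕κ ⟩
    ((toℕ i + k) % (4 * k) / k) mod 2       ≡⟨ cong (_mod 2) (m%[n*o]/o≡m/o%n (toℕ i + k) 4 k) ⟩
    ((toℕ i + k) / k % 4) mod 2             ≡⟨ Z₂.mod-cong {(toℕ i + k) / k % 4} {(toℕ i + k) / k} (m∣n⇒o%n%m≡o%m 2 4 ((toℕ i + k) / k) (divides 2 refl)) ⟩
    ((toℕ i + k) / k) mod 2                 ≡⟨ cong (_mod 2) (trans (+-distrib-/-∣ʳ (toℕ i) (∣-refl {k})) (cong (toℕ i / k +_) (n/n≡1 k))) ⟩
    (toℕ i / k + 1) mod 2                   ≡⟨ Z₂.mod-homo-+ (toℕ i / k) 1 ⟨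
    digit i Z₂.⊕ 1F                         ≡⟨ add-one (digit i) ⟩
    other (digit i)                         ∎
    where
    open ≡-Reasoning
    add-one : ∀ p → p Z₂.⊕ 1F ≡ other p
    add-one 0F = refl
    add-one 1F = refl
    toℕ-i⊕κ : toℕ (i ⊕ κ) ≡ (toℕ i + k) % (4 * k)
    toℕ-i⊕κ = begin
      toℕ (i ⊕ κ)                           ≡⟨ cong (λ x → toℕ (x ⊕ κ)) (mod-toℕ i) ⟨
      toℕ (toℕ i mod (2 * n) ⊕ κ)           ≡⟨ cong toℕ (mod-homo-+ (toℕ i) k) ⟩
      toℕ ((toℕ i + k) mod (2 * n))         ≡⟨ toℕ-mod (toℕ i + k) ⟩
      (toℕ i + k) % (2 * n)                 ≡⟨ %-congʳ {m = 2 * n} {n = 4 * k} 2n≡4k ⟩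
      (toℕ i + k) % (4 * k)                 ∎

  notDCI-1 : ¬ HasDCI Q 1
  notDCI-1 = subst (λ m → ¬ HasDCI Q m) (count-point κ)
    (rotationSet-notDCI S₀ U 𝟎 (λ t → κ≢𝟎 (sym (point⇒≡ 𝟎 κ t))) (λ ()) (point-refl 𝟎)
      (cay-point-≅ Q Φ Ψ ΦΨ ΨΦ Φ-shift U≡b S≡κ))
    where
    open FourCycles digit digit-⊕κ
    S₀ : Subset (Fin (2 * n))
    S₀ i = does (i ≟ κ)
    U : Subset Element
    U (i , 0F) = false
    U (i , 1F) = does (i ≟ 𝟎)
    κ≢𝟎 : κ ≢ 𝟎
    κ≢𝟎 κ≡𝟎 = ν≢𝟎 (trans (sym κ⊕κ) (trans (cong (λ x → x ⊕ x) κ≡𝟎) (⊕-identityˡ 𝟎)))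
    U≡b : ∀ g → g ∈ U ⇔ g ≡ b
    U≡b (i , 0F) = mk⇔ (λ ()) (λ ())
    U≡b (i , 1F) = mk⇔ (λ t → cong (_, 1F) (point⇒≡ i 𝟎 t)) (λ eq → subst (_∈ U) (sym eq) (point-refl 𝟎))
    S≡κ : ∀ g → g ∈ rotations S₀ ⇔ g ≡ (κ , 0F)
    S≡κ (i , 0F) = mk⇔ (λ t → cong (_, 0F) (point⇒≡ i κ t)) (λ eq → subst (_∈ rotations S₀) (sym eq) (point-refl κ))
    S≡κ (i , 1F) = mk⇔ (λ ()) (λ ())

-- n divisible by p²: the sets S and U

-- Here p = q + 1, the subgroup ⟨a^L⟩ has order 2p, ⟨a^D⟩ has order p, and aᶜ
-- is a p-th root of a^D.
module PSquareCase
  (n q c L D : ℕ) .{{_ : NonZero n}} .{{_ : NonZero L}} .{{_ : NonZero D}}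
  (3≤n : 3 ≤ n) (2≤q : 2 ≤ q)
  (D≡L*2 : D ≡ L * 2) (2n≡pD : 2 * n ≡ suc q * D) (pc≡D : suc q * c ≡ D)
  (r t : ℕ) (r≤p : r ≤ suc q) (t≤D : t ≤ D) where

  open DicyclicFacts n

  D∣2n : D ∣ 2 * n
  D∣2n = divides (suc q) 2n≡pD

  L∣D : L ∣ D
  L∣D = divides 2 (trans D≡L*2 (*-comm L 2))

  private
    module ModD = Reduction {2 * n} {D} D∣2n
    module ModL = Reduction {2 * n} {L} (∣-trans L∣D D∣2n)
    module ZD = Residues D
    module ZL = Residues L

  0<D : 0 < D
  0<D = >-nonZero⁻¹ D

  0<L : 0 < L
  0<L = >-nonZero⁻¹ L

  0<c : 0 < c
  0<c = n≢0⇒n>0 λ c≡0 → <⇒≢ 0<D (begin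
    0            ≡⟨ *-zeroʳ (suc q) ⟨
    suc q * 0    ≡⟨ cong (suc q *_) c≡0 ⟨
    suc q * c    ≡⟨ pc≡D ⟩
    D            ∎)
    where open ≡-Reasoning

  c<D : c < D
  c<D = subst (c <_) pc≡D (m<m+n c (≤-trans 0<c (≤-trans (≤-reflexive (sym (*-identityˡ c))) (*-monoˡ-≤ c (≤-trans (s≤s z≤n) 2≤q)))))

  2D<2n : 2 * D < 2 * n
  2D<2n = subst (2 * D <_) (sym 2n≡pD) (*-monoˡ-< D (s≤s 2≤q))

  D<2n : D < 2 * n
  D<2n = ≤-trans (s≤s (m≤m+n D (D + 0))) 2D<2n

  L<D : L < D
  L<D = subst (L <_) (trans (sym (*-suc L 1)) (sym D≡L*2)) (m<m+n L (subst (0 <_) (sym (*-identityʳ L)) 0<L))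

  c≢L : c ≢ L
  c≢L c≡L = <⇒≢ (s≤s 2≤q) (*-cancelʳ-≡ 2 (suc q) L (begin
    2 * L        ≡⟨ *-comm 2 L ⟩
    L * 2        ≡⟨ D≡L*2 ⟨
    D            ≡⟨ pc≡D ⟨
    suc q * c    ≡⟨ cong (suc q *_) c≡L ⟩
    suc q * L    ∎))
    where open ≡-Reasoning

  -- The first is the coset aᶜ⟨a^D⟩. The second selects t of the D cosets of ⟨a^D⟩ outside ⟨a⟩, each
  -- with p elements.
  coset-a^c coset-b : ℕ → Bool
  coset-a^c x = x % D ≡ᵇ c
  coset-b   x = x % D <ᵇ t

  -- Below 2n, `inner₁` holds only at D, and `inner₂` at r members of the coset a^L⟨a^D⟩. All of
  -- them lie in ⟨a^L⟩; this is the part that `U` inverts.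
  inner₁ inner₂ inner : ℕ → Bool
  inner₁ x = (x % D ≡ᵇ 0) ∧ (x / D ≡ᵇ 1)
  inner₂ x = (x % D ≡ᵇ L) ∧ (x / D <ᵇ r)
  inner  x = inner₁ x ∨ inner₂ x

  S U : Subset Element
  S (i , 0F) = coset-a^c (toℕ i) ∨ inner (toℕ i)
  S (i , 1F) = coset-b (toℕ i)
  U (i , 0F) = coset-a^c (toℕ i) ∨ inner (toℕ (⊖ i))
  U (i , 1F) = coset-b (toℕ i)

  inner⇒ : ∀ x → T (inner x) → x % D ≡ 0 × x / D ≡ 1 ⊎ x % D ≡ L
  inner⇒ x t with Equivalence.to T-∨ t
  ... | inj₁ t₁ = let u , v = Equivalence.to T-∧ t₁ in inj₁ (≡ᵇ⇒≡ (x % D) 0 u , ≡ᵇ⇒≡ (x / D) 1 v)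
  ... | inj₂ t₂ = inj₂ (≡ᵇ⇒≡ (x % D) L (proj₁ (Equivalence.to T-∧ t₂)))

  inner⇒L∣ : ∀ x → T (inner x) → x % L ≡ 0
  inner⇒L∣ x t = trans (sym (m∣n⇒o%n%m≡o%m L D x L∣D)) (residue (inner⇒ x t))
    where
    residue : x % D ≡ 0 × x / D ≡ 1 ⊎ x % D ≡ L → x % D % L ≡ 0
    residue (inj₁ (eq , _)) = trans (cong (_% L) eq) (m*n%n≡0 0 L)
    residue (inj₂ eq)       = trans (cong (_% L) eq) (n%n≡0 L)

  blocks : ∀ g h → count {2 * n} ((λ x → g (x % D) ∧ h (x / D)) ∘ toℕ)
                   ≡ count {D} (g ∘ toℕ) * count {suc q} (h ∘ toℕ)
  blocks g h = trans (cong (λ N → count {N} ((λ x → g (x % D) ∧ h (x / D)) ∘ toℕ)) 2n≡pD)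
                     (count-blocks D g h (suc q))

  full-blocks : ∀ g → count {2 * n} ((λ x → g (x % D)) ∘ toℕ) ≡ count {D} (g ∘ toℕ) * suc q
  full-blocks g = trans (count-cong {2 * n} (λ i → sym (∧-identityʳ (g (toℕ i % D)))))
    (trans (blocks g (λ _ → true)) (cong (count {D} (g ∘ toℕ) *_) (count-full (suc q))))

  size : HasSize S (suc q + (1 + r) + t * suc q)
  size = subst (HasSize S) (cong₂ _+_ rotationCount
      (trans (full-blocks (_<ᵇ t)) (cong (_* suc q) (count-< t≤D)))) (hasSize-sheets S)
    where
    c∩inner : ∀ (i : Fin (2 * n)) → T (coset-a^c (toℕ i)) → ¬ T (inner (toℕ i))
    c∩inner i u v with inner⇒ (toℕ i) v
    ... | inj₁ (eq , _) = <⇒≢ 0<c (trans (sym eq) (≡ᵇ⇒≡ _ c u))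
    ... | inj₂ eq       = c≢L (trans (sym (≡ᵇ⇒≡ _ c u)) eq)

    inner₁∩inner₂ : ∀ (i : Fin (2 * n)) → T (inner₁ (toℕ i)) → ¬ T (inner₂ (toℕ i))
    inner₁∩inner₂ i u v = <⇒≢ 0<L (trans (sym (≡ᵇ⇒≡ (toℕ i % D) 0 (proj₁ (Equivalence.to T-∧ u))))
                                          (≡ᵇ⇒≡ (toℕ i % D) L (proj₁ (Equivalence.to T-∧ v))))

    open ≡-Reasoning
    rotationCount : count {2 * n} (λ i → S (i , 0F)) ≡ suc q + (1 + r)
    rotationCount = begin
      count {2 * n} (λ i → S (i , 0F))
        ≡⟨ count-∨ {f = coset-a^c ∘ toℕ} {g = inner ∘ toℕ} c∩inner ⟩
      count {2 * n} (coset-a^c ∘ toℕ) + count {2 * n} (inner ∘ toℕ)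
        ≡⟨ cong (count {2 * n} (coset-a^c ∘ toℕ) +_) (count-∨ {f = inner₁ ∘ toℕ} {g = inner₂ ∘ toℕ} inner₁∩inner₂) ⟩
      count {2 * n} (coset-a^c ∘ toℕ) + (count {2 * n} (inner₁ ∘ toℕ) + count {2 * n} (inner₂ ∘ toℕ))
        ≡⟨ cong₂ _+_ (trans (full-blocks (_≡ᵇ c)) (cong (_* suc q) (count-≡ c<D)))
             (cong₂ _+_
               (trans (blocks (_≡ᵇ 0) (_≡ᵇ 1)) (cong₂ _*_ (count-≡ 0<D) (count-≡ (s≤s (≤-trans (s≤s z≤n) 2≤q)))))
               (trans (blocks (_≡ᵇ L) (_<ᵇ r)) (cong₂ _*_ (count-≡ L<D) (count-< r≤p)))) ⟩
      1 * suc q + (1 * 1 + 1 * r)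
        ≡⟨ cong₂ _+_ (*-identityˡ (suc q)) (cong (1 +_) (*-identityˡ r)) ⟩
      suc q + (1 + r) ∎

  -- n divisible by p²: inversion on each coset of ⟨a^L⟩

  double : Fin (2 * n) → Fin (2 * n)
  double i = (2 * (toℕ i % L)) mod (2 * n)

  -- i = i₀ + L x with 0 ≤ i₀ < L is sent to i₀ − L x.
  φ₀ : Fin (2 * n) → Fin (2 * n)
  φ₀ i = double i ⊝ i

  double-cong : ∀ i j → toℕ i % L ≡ toℕ j % L → double i ≡ double j
  double-cong i j eq = cong (λ x → (2 * x) mod (2 * n)) eq

  residueD : ∀ i j → ModD.ρ i ≡ ModD.ρ j → toℕ i % D ≡ toℕ j % D
  residueD i j = ZD.mod-injective {toℕ i} {toℕ j}

  residueD⇒L : ∀ (i j : Fin (2 * n)) → toℕ i % D ≡ toℕ j % D → toℕ i % L ≡ toℕ j % L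
  residueD⇒L i j eq = trans (sym (m∣n⇒o%n%m≡o%m L D (toℕ i) L∣D))
    (trans (cong (_% L) eq) (m∣n⇒o%n%m≡o%m L D (toℕ j) L∣D))

  -- Reduction modulo L loses a multiple of L, so after doubling a multiple of 2L = D is lost. It
  -- follows that `φ₀` keeps every coset of ⟨a^D⟩.
  ρ-double : ∀ i → ModD.ρ (double i) ≡ ModD.ρ i ZD.⊕ ModD.ρ i
  ρ-double i = begin
    ModD.ρ (double i)        ≡⟨ ModD.ρ-mod (2 * (x % L)) ⟩
    (2 * (x % L)) mod D      ≡⟨ ZD.mod-cong {2 * (x % L)} {x + x} 2[x%L]≡2x ⟩
    (x + x) mod D            ≡⟨ ZD.mod-homo-+ x x ⟨
    ModD.ρ i ZD.⊕ ModD.ρ i   ∎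
    where
    open ≡-Reasoning
    x = toℕ i
    instance
      L*2≢0 : NonZero (L * 2)
      L*2≢0 = m*n≢0 L 2
    2[x%L]≡2x : (2 * (x % L)) % D ≡ (x + x) % D
    2[x%L]≡2x = begin
      (2 * (x % L)) % D          ≡⟨ cong (_% D) (*-comm 2 (x % L)) ⟩
      (x % L * 2) % D            ≡⟨ cong (_% D) (m%n*o≡m*o%[n*o] x L 2) ⟩
      (x * 2) % (L * 2) % D      ≡⟨ cong (_% D) (%-congʳ {m = L * 2} {n = D} (sym D≡L*2)) ⟩
      (x * 2) % D % D            ≡⟨ m%n%n≡m%n (x * 2) D ⟩
      (x * 2) % D                ≡⟨ cong (_% D) (trans (*-comm x 2) (cong (x +_) (+-identityʳ x))) ⟩
      (x + x) % D                ∎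

  ρ-φ₀ : ∀ i → ModD.ρ (φ₀ i) ≡ ModD.ρ i
  ρ-φ₀ i = trans (ModD.ρ-⊝ (double i) i)
    (trans (cong (ZD._⊝ ModD.ρ i) (ρ-double i)) (ZD.⊕-⊝ (ModD.ρ i) (ModD.ρ i)))

  φ₀-residueL : ∀ i → toℕ (φ₀ i) % L ≡ toℕ i % L
  φ₀-residueL i = residueD⇒L (φ₀ i) i (residueD (φ₀ i) i (ρ-φ₀ i))

  φ₀-involutive : ∀ i → φ₀ (φ₀ i) ≡ i
  φ₀-involutive i = trans (cong (_⊝ φ₀ i) (double-cong (φ₀ i) i (φ₀-residueL i)))
                          (i⊝[i⊝j]≡j (double i) i)

  -- Within one coset of ⟨a^L⟩, `φ₀` is a single reflection x ↦ 2i₀ - x.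
  φ₀-reverses : ∀ i k → toℕ k % L ≡ toℕ i % L → φ₀ k ⊝ φ₀ i ≡ ⊖ (k ⊝ i)
  φ₀-reverses i k eq = begin
    (double k ⊝ k) ⊝ (double i ⊝ i)   ≡⟨ cong (λ y → (y ⊝ k) ⊝ (double i ⊝ i)) (double-cong k i eq) ⟩
    (double i ⊝ k) ⊝ (double i ⊝ i)   ≡⟨ [k⊝i]⊝[k⊝j]≡j⊝i (double i) k i ⟩
    i ⊝ k                             ≡⟨ ⊖-anti-⊝ k i ⟨
    ⊖ (k ⊝ i)                         ∎
    where open ≡-Reasoning

  L∣⊝⇒ : ∀ i k → toℕ (k ⊝ i) % L ≡ 0 → toℕ k % L ≡ toℕ i % L
  L∣⊝⇒ i k eq = ZL.mod-injective {toℕ k} {toℕ i} (ZL.⊝≡𝟎⇒≡ (ModL.ρ k) (ModL.ρ i)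
    (trans (sym (ModL.ρ-⊝ k i)) (ZL.mod-cong {toℕ (k ⊝ i)} {0} (trans eq (sym (m*n%n≡0 0 L))))))

  toℕ-𝟎 : toℕ {2 * n} 𝟎 ≡ 0
  toℕ-𝟎 = trans (toℕ-mod 0) (m*n%n≡0 0 (2 * n))

  L∣⊖⇒ : ∀ i → toℕ (⊖ i) % L ≡ 0 → toℕ i % L ≡ 0
  L∣⊖⇒ i eq = trans (sym (L∣⊝⇒ i 𝟎 (trans (cong (λ (x : Fin (2 * n)) → toℕ x % L) (⊕-identityˡ (⊖ i))) eq)))
    (trans (cong (_% L) toℕ-𝟎) (m*n%n≡0 0 L))

  φ : Element → Element
  φ (i , l) = φ₀ i , l

  -- The coset aᶜ⟨a^D⟩ is recognised modulo D, where `φ₀` acts as the identity. The inner parts join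
  -- only vertices in a common coset of ⟨a^L⟩, where `φ₀` negates the difference.
  rotationQuotient : ∀ i k → (k ⊝ i , 0F) ∈ U ⇔ (φ₀ k ⊝ φ₀ i , 0F) ∈ S
  rotationQuotient i k = mk⇔ fwd bwd
    where
    same : toℕ (k ⊝ i) % D ≡ toℕ (φ₀ k ⊝ φ₀ i) % D
    same = residueD (k ⊝ i) (φ₀ k ⊝ φ₀ i) (trans (ModD.ρ-⊝ k i)
      (trans (sym (cong₂ ZD._⊝_ (ρ-φ₀ k) (ρ-φ₀ i))) (sym (ModD.ρ-⊝ (φ₀ k) (φ₀ i)))))
    fwd : (k ⊝ i , 0F) ∈ U → (φ₀ k ⊝ φ₀ i , 0F) ∈ S
    fwd t with Equivalence.to T-∨ t
    ... | inj₁ u = Equivalence.from T-∨ (inj₁ (subst (λ x → T (x ≡ᵇ c)) same u))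
    ... | inj₂ v = Equivalence.from (T-∨ {coset-a^c (toℕ (φ₀ k ⊝ φ₀ i))}) (inj₂ (subst (λ x → T (inner (toℕ x)))
                     (sym (φ₀-reverses i k (L∣⊝⇒ i k (L∣⊖⇒ (k ⊝ i) (inner⇒L∣ (toℕ (⊖ (k ⊝ i))) v))))) v))
    bwd : (φ₀ k ⊝ φ₀ i , 0F) ∈ S → (k ⊝ i , 0F) ∈ U
    bwd t with Equivalence.to T-∨ t
    ... | inj₁ u = Equivalence.from T-∨ (inj₁ (subst (λ x → T (x ≡ᵇ c)) (sym same) u))
    ... | inj₂ v = Equivalence.from (T-∨ {coset-a^c (toℕ (k ⊝ i))}) (inj₂ (subst (λ x → T (inner (toℕ x)))
                     (φ₀-reverses i k (trans (sym (φ₀-residueL k))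
                       (trans (L∣⊝⇒ (φ₀ i) (φ₀ k) (inner⇒L∣ (toℕ (φ₀ k ⊝ φ₀ i)) v)) (φ₀-residueL i)))) v))

  reflectionQuotient : ∀ x y → ModD.ρ x ≡ ModD.ρ y → (x , 1F) ∈ U ⇔ (y , 1F) ∈ S
  reflectionQuotient x y eq = mk⇔ (subst (λ z → T (z <ᵇ t)) same) (subst (λ z → T (z <ᵇ t)) (sym same))
    where
    same : toℕ x % D ≡ toℕ y % D
    same = residueD x y eq

  quotients : ∀ u v → (v · u ⁻¹ ∈ U) ⇔ (φ v · φ u ⁻¹ ∈ S)
  quotients (i , 0F) (k , 0F) = rotationQuotient i k
  quotients (i , 0F) (k , 1F) = reflectionQuotient (k ⊝ ⊖ i) (φ₀ k ⊝ ⊖ φ₀ i) (begin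
    ModD.ρ (k ⊝ ⊖ i)                          ≡⟨ ρ-⊝⊖ k i ⟩
    ModD.ρ k ZD.⊝ (ZD.⊖ ModD.ρ i)             ≡⟨ cong₂ (λ x y → x ZD.⊝ (ZD.⊖ y)) (ρ-φ₀ k) (ρ-φ₀ i) ⟨
    ModD.ρ (φ₀ k) ZD.⊝ (ZD.⊖ ModD.ρ (φ₀ i))   ≡⟨ ρ-⊝⊖ (φ₀ k) (φ₀ i) ⟨
    ModD.ρ (φ₀ k ⊝ ⊖ φ₀ i)                    ∎)
    where
    open ≡-Reasoning
    ρ-⊝⊖ : ∀ x y → ModD.ρ (x ⊝ ⊖ y) ≡ ModD.ρ x ZD.⊝ (ZD.⊖ ModD.ρ y)
    ρ-⊝⊖ x y = trans (ModD.ρ-⊝ x (⊖ y)) (cong (ModD.ρ x ZD.⊝_) (ModD.ρ-⊖ y))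
  quotients (i , 1F) (k , 0F) = reflectionQuotient (k ⊕ (i ⊕ ν)) (φ₀ k ⊕ (φ₀ i ⊕ ν)) (begin
    ModD.ρ (k ⊕ (i ⊕ ν))                                 ≡⟨ ρ-⊕⊕ k i ⟩
    ModD.ρ k ZD.⊕ (ModD.ρ i ZD.⊕ ModD.ρ ν)               ≡⟨ cong₂ (λ x y → x ZD.⊕ (y ZD.⊕ ModD.ρ ν)) (ρ-φ₀ k) (ρ-φ₀ i) ⟨
    ModD.ρ (φ₀ k) ZD.⊕ (ModD.ρ (φ₀ i) ZD.⊕ ModD.ρ ν)     ≡⟨ ρ-⊕⊕ (φ₀ k) (φ₀ i) ⟨
    ModD.ρ (φ₀ k ⊕ (φ₀ i ⊕ ν))                           ∎)
    where
    open ≡-Reasoning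
    ρ-⊕⊕ : ∀ x y → ModD.ρ (x ⊕ (y ⊕ ν)) ≡ ModD.ρ x ZD.⊕ (ModD.ρ y ZD.⊕ ModD.ρ ν)
    ρ-⊕⊕ x y = trans (ModD.ρ-⊕ x (y ⊕ ν)) (cong (ModD.ρ x ZD.⊕_) (ModD.ρ-⊕ y ν))
  quotients (i , 1F) (k , 1F) = mk⇔
    (λ u → subst (λ x → (x , 0F) ∈ S) (sym (k⊝[i⊕ν]⊕ν (φ₀ k) (φ₀ i)))
             (to (rotationQuotient i k) (subst (λ x → (x , 0F) ∈ U) (k⊝[i⊕ν]⊕ν k i) u)))
    (λ u → subst (λ x → (x , 0F) ∈ U) (sym (k⊝[i⊕ν]⊕ν k i))
             (from (rotationQuotient i k) (subst (λ x → (x , 0F) ∈ S) (k⊝[i⊕ν]⊕ν (φ₀ k) (φ₀ i)) u)))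
    where open Equivalence

  φ-involutive : ∀ u → φ (φ u) ≡ u
  φ-involutive (i , l) = cong (_, l) (φ₀-involutive i)

  iso : Cay Q U ≅ Cay Q S
  iso = cay-≅ Q φ φ φ-involutive φ-involutive quotients

  -- n divisible by p²: no automorphism takes S to U

  toℕ-mod-< : ∀ {x} → x < 2 * n → toℕ (x mod (2 * n)) ≡ x
  toℕ-mod-< {x} x<2n = trans (toℕ-mod x) (m<n⇒m%n≡m x<2n)

  0∉ : ¬ T (coset-a^c 0 ∨ inner 0)
  0∉ t with Equivalence.to T-∨ t
  ... | inj₁ u = <⇒≢ 0<c (trans (sym (m*n%n≡0 0 D)) (≡ᵇ⇒≡ (0 % D) c u))
  ... | inj₂ v with inner⇒ 0 v
  ...   | inj₁ (_ , eq) = 0≢1+n (trans (sym (0/n≡0 D)) eq)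
  ...   | inj₂ eq       = <⇒≢ 0<L (trans (sym (m*n%n≡0 0 D)) eq)

  e∉S : e ∉ S
  e∉S t = 0∉ (subst (λ x → T (coset-a^c x ∨ inner x)) toℕ-𝟎 t)

  e∉U : e ∉ U
  e∉U t = 0∉ (subst₂ (λ x y → T (coset-a^c x ∨ inner y)) toℕ-𝟎 (trans (cong toℕ ⊖-𝟎) toℕ-𝟎) t)

  root rootᵖ : Fin (2 * n)
  root    = c mod (2 * n)
  rootᵖ = D mod (2 * n)

  toℕ-root : toℕ root ≡ c
  toℕ-root = toℕ-mod-< (<-trans c<D D<2n)

  toℕ-rootᵖ : toℕ rootᵖ ≡ D
  toℕ-rootᵖ = toℕ-mod-< D<2n

  root∈S : (root , 0F) ∈ S
  root∈S = Equivalence.from T-∨ (inj₁ (≡⇒≡ᵇ (toℕ root % D) c (trans (cong (_% D) toℕ-root) (m<n⇒m%n≡m c<D))))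

  rootᵖ∈S : (rootᵖ , 0F) ∈ S
  rootᵖ∈S = subst (λ x → T (coset-a^c x ∨ inner x)) (sym toℕ-rootᵖ)
    (Equivalence.from (T-∨ {coset-a^c D}) (inj₂ (Equivalence.from (T-∨ {inner₁ D}) (inj₁ (Equivalence.from T-∧
      (≡⇒≡ᵇ (D % D) 0 (n%n≡0 D) , ≡⇒≡ᵇ (D / D) 1 (n/n≡1 D)))))))

  toℕ-⊖rootᵖ : toℕ (⊖ rootᵖ) ≡ q * D
  toℕ-⊖rootᵖ = begin
    toℕ ((2 * n ∸ toℕ rootᵖ) mod (2 * n))  ≡⟨ toℕ-mod (2 * n ∸ toℕ rootᵖ) ⟩
    (2 * n ∸ toℕ rootᵖ) % (2 * n)          ≡⟨ cong (_% (2 * n)) (trans (cong₂ _∸_ 2n≡pD toℕ-rootᵖ) (m+n∸m≡n D (q * D))) ⟩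
    (q * D) % (2 * n)                        ≡⟨ m<n⇒m%n≡m (subst (q * D <_) (sym 2n≡pD) (m<n+m (q * D) 0<D)) ⟩
    q * D                                    ∎
    where open ≡-Reasoning

  -- The inverse of a^D is a^(qD) with q = p - 1 ≥ 2: the quotient of qD by D is not 1, and its
  -- residue is 0 rather than c or L.
  rootᵖ∉U : (rootᵖ , 0F) ∉ U
  rootᵖ∉U t with Equivalence.to (T-∨ {coset-a^c (toℕ rootᵖ)}) t
  ... | inj₁ u = <⇒≢ 0<c (trans (sym (trans (cong (_% D) toℕ-rootᵖ) (n%n≡0 D))) (≡ᵇ⇒≡ (toℕ rootᵖ % D) c u))
  ... | inj₂ v with inner⇒ (q * D) (subst (λ x → T (inner x)) toℕ-⊖rootᵖ v)
  ...   | inj₁ (_ , eq) = <⇒≢ 2≤q (sym (trans (sym (m*n/n≡m q D)) eq))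
  ...   | inj₂ eq       = <⇒≢ 0<L (trans (sym (m*n%n≡0 q D)) eq)

  pow-root : pow (suc q) (root , 0F) ≡ (rootᵖ , 0F)
  pow-root = trans (pow-rotation (suc q) root)
    (cong (λ x → x mod (2 * n) , 0F) (trans (cong (suc q *_) toℕ-root) pc≡D))

  -- The factor from ⟨a^D⟩ vanishes in the p-th power because pD = 2n.
  pow-coset : ∀ i → toℕ i % D ≡ c → pow (suc q) (i , 0F) ≡ (rootᵖ , 0F)
  pow-coset i eq = trans (pow-rotation (suc q) i) (cong (_, 0F) (mod-cong {suc q * x} {D} (begin
    (suc q * x) % (2 * n)                            ≡⟨ cong (λ y → (suc q * y) % (2 * n)) (m≡m%n+[m/n]*n x D) ⟩
    (suc q * (x % D + x / D * D)) % (2 * n)          ≡⟨ cong (_% (2 * n)) (expand (suc q) (x % D) (x / D) D) ⟩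
    (suc q * (x % D) + x / D * (suc q * D)) % (2 * n) ≡⟨ cong₂ (λ y z → (y + x / D * z) % (2 * n)) (trans (cong (suc q *_) eq) pc≡D) (sym 2n≡pD) ⟩
    (D + x / D * (2 * n)) % (2 * n)                  ≡⟨ [m+kn]%n≡m%n D (x / D) (2 * n) ⟩
    D % (2 * n)                                      ∎)))
    where
    open ≡-Reasoning
    x = toℕ i
    expand : ∀ p y z D → p * (y + z * D) ≡ p * y + z * (p * D)
    expand = solve-∀

  pow-L∣ : ∀ i → toℕ i % L ≡ 0 → pow (2 * suc q) (i , 0F) ≡ e
  pow-L∣ i eq = trans (pow-rotation (2 * suc q) i) (cong (_, 0F) (mod-cong {2 * suc q * x} {0} (begin
    (2 * suc q * x) % (2 * n)                        ≡⟨ cong (λ y → (2 * suc q * y) % (2 * n)) (trans (m≡m%n+[m/n]*n x L) (cong (_+ x / L * L) eq)) ⟩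
    (2 * suc q * (x / L * L)) % (2 * n)              ≡⟨ cong (_% (2 * n)) (regroup (suc q) (x / L) L) ⟩
    (x / L * (suc q * (L * 2))) % (2 * n)            ≡⟨ cong (λ y → (x / L * y) % (2 * n)) (trans (cong (suc q *_) (sym D≡L*2)) (sym 2n≡pD)) ⟩
    (x / L * (2 * n)) % (2 * n)                      ≡⟨ m*n%n≡0 (x / L) (2 * n) ⟩
    0                                                ≡⟨ m*n%n≡0 0 (2 * n) ⟨
    0 % (2 * n)                                      ∎)))
    where
    open ≡-Reasoning
    x = toℕ i
    regroup : ∀ p z L → 2 * p * (z * L) ≡ z * (p * (L * 2))
    regroup = solve-∀

  -- The exponent is 2pc = 2D, strictly between 0 and pD = 2n as p ≥ 3. Together with `pow-L∣` this
  -- keeps automorphisms from moving aᶜ into ⟨a^L⟩.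
  pow-root≢e : pow (2 * suc q) (root , 0F) ≢ e
  pow-root≢e eq = mod≢𝟎 (≤-trans 0<D (m≤m+n D (D + 0))) 2D<2n (begin
    (2 * D) mod (2 * n)                      ≡⟨ cong (_mod (2 * n)) (cong (2 *_) (sym pc≡D)) ⟩
    (2 * (suc q * c)) mod (2 * n)            ≡⟨ cong (_mod (2 * n)) (sym (*-assoc 2 (suc q) c)) ⟩
    (2 * suc q * c) mod (2 * n)              ≡⟨ cong (λ x → (2 * suc q * x) mod (2 * n)) toℕ-root ⟨
    (2 * suc q * toℕ root) mod (2 * n)       ≡⟨ cong proj₁ (trans (sym (pow-rotation (2 * suc q) root)) eq) ⟩
    𝟎                                        ∎)
    where open ≡-Reasoning

  -- The image of aᶜ lies in its own ⟨a^D⟩-coset, so its p-th power a^D is fixed.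
  noAutomorphism : ∀ σ → IsAutomorphism Q σ → ¬ IsImage Q σ S U
  noAutomorphism σ aut image = locate (σ (root , 0F)) refl
    where
    maps : ∀ g → g ∈ S → σ g ∈ U
    maps g g∈S = Equivalence.from (image (σ g)) (g , g∈S , refl)
    locate : ∀ u → σ (root , 0F) ≢ u
    locate (i , 1F) eq = rotation-invariant 3≤n aut root i eq
    locate (i , 0F) eq with Equivalence.to T-∨ (subst (_∈ U) eq (maps (root , 0F) root∈S))
    ... | inj₁ u = rootᵖ∉U (subst (_∈ U) fixed (maps (rootᵖ , 0F) rootᵖ∈S))
      where
      open ≡-Reasoning
      fixed : σ (rootᵖ , 0F) ≡ (rootᵖ , 0F)
      fixed = begin
        σ (rootᵖ , 0F)               ≡⟨ cong σ pow-root ⟨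
        σ (pow (suc q) (root , 0F))    ≡⟨ aut-pow Q aut (suc q) (root , 0F) ⟩
        pow (suc q) (σ (root , 0F))    ≡⟨ cong (pow (suc q)) eq ⟩
        pow (suc q) (i , 0F)           ≡⟨ pow-coset i (≡ᵇ⇒≡ (toℕ i % D) c u) ⟩
        (rootᵖ , 0F)                 ∎
    -- An image in the inner part would lie in ⟨a^L⟩, of order 2p, so the 2p-th power of aᶜ would be
    -- trivial.
    ... | inj₂ v = pow-root≢e (aut-pow-ε Q aut (2 * suc q) (root , 0F)
                     (trans (cong (pow (2 * suc q)) eq) (pow-L∣ i (L∣⊖⇒ i (inner⇒L∣ (toℕ (⊖ i)) v)))))

  notDCI : ¬ HasDCI Q (suc q + (1 + r) + t * suc q)
  notDCI dci = let σ , aut , image = dci S e∉S size U e∉U iso in noAutomorphism σ aut image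

-- Choice of parameters and conclusion

even⇒notDCI : (n : ℕ) .{{_ : NonZero n}} → 3 ≤ n → (m : ℕ) → 1 ≤ m → m ≤ 2 * n ∸ 1 →
              2 ∣ n → ¬ HasDCI (Q₄ n) m
even⇒notDCI n 3≤n m 1≤m m≤ (divides k n≡k*2) = byValency m 1≤m m≤
  where
  instance
    k≢0 : NonZero k
    k≢0 = ≢-nonZero λ { refl → ≢-nonZero⁻¹ n n≡k*2 }
  open EvenCase n k n≡k*2 3≤n
  byValency : ∀ m → 1 ≤ m → m ≤ 2 * n ∸ 1 → ¬ HasDCI (Q₄ n) m
  byValency (suc zero)    _ _  = notDCI-1
  byValency (suc (suc m)) _ m≤ = notDCI-≥2 (suc (suc m)) (s≤s (s≤s z≤n)) m≤

-- With n = dp² the parameters are c = 2d, L = pd and D = 2pd. Dividing m - (p + 1) by p gives the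
-- number t of cosets outside ⟨a⟩ and the number r of elements taken from a^L⟨a^D⟩.
square⇒notDCI : (n : ℕ) .{{_ : NonZero n}} → 3 ≤ n → (m p : ℕ) → m ≤ 2 * n ∸ 1 → 3 ≤ p →
                suc p ≤ m → p ^ 2 ∣ n → ¬ HasDCI (Q₄ n) m
square⇒notDCI n 3≤n m p@(suc q) m≤ (s≤s 2≤q) p<m (divides d n≡) =
  subst (λ m → ¬ HasDCI (Q₄ n) m) size (PSquareCase.notDCI n q (d * 2) L D 3≤n 2≤q refl
    2n≡pD (pc≡D p d) r t (<⇒≤ (m%n<n m′ p)) (<⇒≤ (m<n*o⇒m/o<n m′<D*p)))
  where
  m′ = m ∸ suc p
  r = m′ % p
  t = m′ / p
  L = p * d
  D = L * 2
  instance
    d≢0 : NonZero d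
    d≢0 = ≢-nonZero λ { refl → ≢-nonZero⁻¹ n n≡ }
    L≢0 : NonZero L
    L≢0 = m*n≢0 p d
    D≢0 : NonZero D
    D≢0 = m*n≢0 L 2
  pc≡D : ∀ p d → p * (d * 2) ≡ p * d * 2
  pc≡D = solve-∀
  regroup : ∀ p d → 2 * (d * (p * (p * 1))) ≡ p * (p * d * 2)
  regroup = solve-∀
  2n≡pD : 2 * n ≡ p * D
  2n≡pD = trans (cong (2 *_) n≡) (regroup p d)
  -- This keeps t within D, the number of cosets of ⟨a^D⟩ available outside ⟨a⟩.
  m′<D*p : m′ < D * p
  m′<D*p = begin-strict
    m ∸ suc p     <⟨ ∸-monoʳ-< (s≤s z≤n) p<m ⟩
    m             ≤⟨ m≤ ⟩
    2 * n ∸ 1     ≤⟨ m∸n≤m (2 * n) 1 ⟩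
    2 * n         ≡⟨ 2n≡pD ⟩
    p * D         ≡⟨ *-comm p D ⟩
    D * p         ∎
    where open ≤-Reasoning
  assemble : ∀ p r s → p + (1 + r) + s ≡ suc p + (r + s)
  assemble = solve-∀
  size : p + (1 + r) + t * p ≡ m
  size = trans (assemble p r (t * p)) (trans (cong (suc p +_) (sym (m≡m%n+[m/n]*n m′ p))) (m+[n∸m]≡n p<m))

theorem1p1 : (n : ℕ) .{{_ : NonZero n}} → 3 ≤ n →
    (m : ℕ) → 1 ≤ m → m ≤ 2 * n ∸ 1 → HasDCI (Q₄ n) m →
    ¬ (2 ∣ n) × ((p : ℕ) → Prime p → p ≤ m ∸ 1 → ¬ (p ^ 2 ∣ n))
theorem1p1 n 3≤n m 1≤m m≤ dci = odd , squarefree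
  where
  odd : ¬ (2 ∣ n)
  odd 2∣n = even⇒notDCI n 3≤n m 1≤m m≤ 2∣n dci
  squarefree : (p : ℕ) → Prime p → p ≤ m ∸ 1 → ¬ (p ^ 2 ∣ n)
  squarefree 0 0-prime _ _ = ¬prime[0] 0-prime
  squarefree 1 1-prime _ _ = ¬prime[1] 1-prime
  -- The prime 2 falls under the even case, since 4 ∣ n gives 2 ∣ n.
  squarefree 2 _ _ 4∣n = odd (∣-trans (divides 2 refl) 4∣n)
  squarefree p@(suc (suc (suc _))) _ p≤ p²∣n =
    square⇒notDCI n 3≤n m p m≤ (s≤s (s≤s (s≤s z≤n))) (subst (suc p ≤_) (m+[n∸m]≡n 1≤m) (s≤s p≤)) p²∣n dci
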